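{- Let $G$ be an $n$-vertex graph of maximum degree $3$ that arises from a binary tree by replacing its vertices by cycles, and let $S$ be an $n \times n$ grid point set. Then $G$ admits a restricted RAC$_1$ embedding on $S$.
   Context: "Arising from a binary tree by replacing its vertices by cycles" means: there is a binary tree $T$ such that $G$ is obtained by replacing each vertex $t$ of $T$ by a cycle $C_t$ (with at least 3 vertices), and each edge $st$ of $T$ by an edge joining some vertex of $C_s$ to some vertex of $C_t$; the resulting graph $G$ has maximum degree 3. An $n \times n$ grid point set is a set $S$ of $n$ points with integer coordinates in $\{1,\dots,n\}^2$ such that no two points of $S$ lie on a common horizontal or a common vertical line. A point-set embedding of an $n$-vertex graph $G=(V,E)$ on $S$ consists of a bijection $\mu: V \to S$ and a polyline drawing of $G$ in which each vertex $v$ is drawn at $\mu(v)$ and each edge is a polygonal chain between the images of its endpoints; edges may not overlap and may not pass through points representing other vertices. A restricted RAC$_1$ embedding is such an embedding in which every bend lies on an integer grid point, every edge segment is horizontal or vertical (lies on a grid line), every edge has at most one bend, and any two crossing edges cross at a right angle. The bijection $\mu$ may be chosen freely. -}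

module Defs where

open import Data.Nat using (ℕ; zero; suc; _+_)
import Data.Nat as ℕ
open import Data.Fin using (Fin; zero; suc; _↑ˡ_; _↑ʳ_; inject₁; fromℕ) renaming (_≟_ to _≟ᶠ_)
open import Data.List using (List; []; _∷_; _++_; map; length; lookup)
open import Data.List.Membership.Propositional using (_∈_)
open import Data.Maybe using (Maybe; just; nothing)
open import Data.Product using (Σ; Σ-syntax; _×_; _,_; proj₁; proj₂)
open import Data.Sum using (_⊎_)
open import Data.Bool using (if_then_else_; _∨_)
open import Data.Integer using (ℤ; +_) renaming (_≤_ to _≤ℤ_)
open import Relation.Nullary using (¬_; does)
open import Relation.Binary.PropositionalEquality using (_≡_; _≢_)
open import Function.Definitions using (Bijective)

record Graph : Set where
  field
    V : ℕ
    m : ℕ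
    E : Fin m → Fin V × Fin V
open Graph public

sumFin : ∀ {k} → (Fin k → ℕ) → ℕ
sumFin {zero}  f = 0
sumFin {suc k} f = f zero + sumFin (λ i → f (suc i))

deg : (G : Graph) → Fin (V G) → ℕ
deg G v = sumFin (λ e → if does (v ≟ᶠ proj₁ (E G e)) ∨ does (v ≟ᶠ proj₂ (E G e)) then 1 else 0)

MaxDegAtMost : ℕ → Graph → Set
MaxDegAtMost d G = ∀ v → deg G v ℕ.≤ d

-- Graphs arising from a binary tree by replacing its vertices by cycles.
--
-- CycTree k : a rooted binary tree whose root is replaced by a cycle of
-- length k (always k = 3 + j, i.e. at least 3).  Each child entry records
-- the vertex a of the parent cycle and the vertex b of the child's root
-- cycle that are joined by the tree edge.

mutual
  data CycTree : ℕ → Set where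
    node : (j : ℕ) → Children (3 + j) → CycTree (3 + j)

  data Children (k : ℕ) : Set where
    none : Children k
    one  : {j : ℕ} → Fin k → Fin j → CycTree j → Children k
    two  : {j j' : ℕ} → Fin k → Fin j → CycTree j →
                        Fin k → Fin j' → CycTree j' → Children k

mutual
  size : ∀ {k} → CycTree k → ℕ
  size (node j ch) = (3 + j) + csize ch

  csize : ∀ {k} → Children k → ℕ
  csize none            = 0
  csize (one _ _ c)     = size c
  csize (two _ _ c _ _ c') = size c + size c'

rootV : ∀ {k} (c : CycTree k) → Fin k → Fin (size c)
rootV (node j ch) b = b ↑ˡ csize ch

cycleEdges : (p : ℕ) → List (Fin (suc p) × Fin (suc p))
cycleEdges p = (fromℕ p , zero) ∷ map (λ i → (inject₁ i , suc i)) (Data.List.allFin p)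
  where import Data.List

mapPair : ∀ {A B : Set} → (A → B) → List (A × A) → List (B × B)
mapPair f = map (λ e → (f (proj₁ e) , f (proj₂ e)))

mutual
  edges : ∀ {k} (c : CycTree k) → List (Fin (size c) × Fin (size c))
  edges (node j ch) =
    mapPair (λ i → i ↑ˡ csize ch) (cycleEdges (2 + j)) ++
    cedges ch

  -- edges inside the children, together with the tree edges to the parent
  -- cycle (parent-cycle vertices are Fin k, placed before the children)
  cedges : ∀ {k} (ch : Children k) → List (Fin (k + csize ch) × Fin (k + csize ch))
  cedges {k} none = []
  cedges {k} (one a b c) =
    (a ↑ˡ size c , k ↑ʳ rootV c b) ∷ mapPair (λ i → k ↑ʳ i) (edges c)
  cedges {k} (two a b c a' b' c') =
    (a ↑ˡ (size c + size c') , k ↑ʳ (rootV c b ↑ˡ size c')) ∷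
    (a' ↑ˡ (size c + size c') , k ↑ʳ (size c ↑ʳ rootV c' b')) ∷
    mapPair (λ i → k ↑ʳ (i ↑ˡ size c')) (edges c) ++
    mapPair (λ i → k ↑ʳ (size c ↑ʳ i)) (edges c')

toGraph : ∀ {k} → CycTree k → Graph
toGraph c = record { V = size c ; m = length (edges c) ; E = lookup (edges c) }

Point : Set
Point = ℤ × ℤ

px py : Point → ℤ
px = proj₁
py = proj₂

Segment : Set
Segment = Point × Point

Between : ℤ → ℤ → ℤ → Set
Between a p b = (a ≤ℤ p × p ≤ℤ b) ⊎ (b ≤ℤ p × p ≤ℤ a)

-- P lies on the (closed) axis-parallel segment s
OnSeg : Point → Segment → Set
OnSeg P (A , B) = Between (px A) (px P) (px B) × Between (py A) (py P) (py B)

Interior : Point → Segment → Set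
Interior P (A , B) = OnSeg P (A , B) × P ≢ A × P ≢ B

Horizontal Vertical : Segment → Set
Horizontal (A , B) = py A ≡ py B
Vertical   (A , B) = px A ≡ px B

AxisSeg : Segment → Set
AxisSeg (A , B) = (Horizontal (A , B) ⊎ Vertical (A , B)) × A ≢ B

Perp : Segment → Segment → Set
Perp s t = (Horizontal s × Vertical t) ⊎ (Vertical s × Horizontal t)

GridPointSet : (n : ℕ) → (Fin n → Point) → Set
GridPointSet n S =
  (∀ i → (+ 1 ≤ℤ px (S i) × px (S i) ≤ℤ + n) × (+ 1 ≤ℤ py (S i) × py (S i) ≤ℤ + n)) ×
  (∀ i j → i ≢ j → px (S i) ≢ px (S j) × py (S i) ≢ py (S j))

polySegs : Point → Maybe Point → Point → List Segment
polySegs A nothing  B = (A , B) ∷ []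
polySegs A (just b) B = (A , b) ∷ (b , B) ∷ []

record RestrictedRAC₁ (G : Graph) (S : Fin (V G) → Point) : Set where
  field
    μ      : Fin (V G) → Fin (V G)
    μ-bij  : Bijective _≡_ _≡_ μ
    bend   : Fin (m G) → Maybe Point

  pos : Fin (V G) → Point
  pos v = S (μ v)

  src : Fin (m G) → Fin (V G)
  src e = proj₁ (E G e)

  tgt : Fin (m G) → Fin (V G)
  tgt e = proj₂ (E G e)

  segs : Fin (m G) → List Segment
  segs e = polySegs (pos (src e)) (bend e) (pos (tgt e))

  field
    axis      : ∀ e s → s ∈ segs e → AxisSeg s
    bend-perp : ∀ e b → bend e ≡ just b →
                Perp (pos (src e) , b) (b , pos (tgt e))
    avoid     : ∀ e w → w ≢ src e → w ≢ tgt e → ∀ s → s ∈ segs e →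
                ¬ OnSeg (pos w) s
    crossing  : ∀ e f → e ≢ f → ∀ s t → s ∈ segs e → t ∈ segs f →
                ∀ P → OnSeg P s → OnSeg P t →
                (Σ[ w ∈ Fin (V G) ] (w ≡ src e ⊎ w ≡ tgt e) ×
                                    (w ≡ src f ⊎ w ≡ tgt f) × P ≡ pos w)
                ⊎ (Perp s t × Interior P s × Interior P t)

{-# OPTIONS --safe #-}
module Submission where

-- Since no two points share a row or a column, every edge must be an L that
-- leaves one end horizontally and the other vertically.  Such a drawing is
-- legal as soon as, at every vertex, two edges leaving it horizontally leave
-- to opposite sides, and likewise vertically.
--
-- Recursively, a subtree occupies an interval of columns: the first child
-- subtree, then the root cycle, then the second child subtree.  An edge to a
-- child leaves the parent cycle horizontally (to the left for the first child,
-- to the right for the second) and enters the child cycle vertically.  The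
-- degree bound makes the attachment vertices b (to the parent), l and r (to
-- the children) of a cycle distinct, so it remains to draw a cycle on
-- consecutive columns with b free vertically on the side of a given point q,
-- l free to the left and r free to the right.
--
-- Orient the cycle so that each vertex meets its successor horizontally and
-- its predecessor vertically; this is legal for any placement.  Two of any
-- three columns lie on the same side of q vertically, so b and its
-- predecessor can be placed with b vertically between q and the predecessor;
-- placing l and r at extreme remaining columns settles the rest when the cycle
-- has at least four vertices.  In a triangle, l, b, r are placed in this order
-- and the orientations of the edges depend on which point is the vertical median.

open import Defs
open import Data.Bool using (if_then_else_; _∨_)
open import Data.Empty using (⊥)
open import Data.Fin using (Fin; zero; suc; toℕ; fromℕ; fromℕ<; inject₁; lower₁; punchOut; splitAt; join; _↑ˡ_; _↑ʳ_) renaming (_≟_ to _≟ᶠ_)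
import Data.Fin.Properties as Fin
open import Data.Integer using (ℤ; +_; +≤+; +<+) renaming (_<_ to _<ℤ_; _≤_ to _≤ℤ_)
import Data.Integer.Properties as ℤ
open import Data.List using (List; []; _∷_; _++_; length; lookup; map; tabulate)
open import Data.List.Membership.Propositional using (_∈_)
open import Data.List.Properties using (map-++; map-tabulate)
open import Data.List.Relation.Binary.Permutation.Propositional using (_↭_; prep; swap; ↭-refl; ↭-trans; ↭⇒↭ₛ)
open import Data.List.Relation.Binary.Permutation.Propositional.Properties using (All-resp-↭)
import Data.List.Relation.Binary.Permutation.Setoid.Properties as Permutationₛ
open import Data.List.Relation.Binary.Pointwise using (Pointwise; []; _∷_)
import Data.List.Relation.Binary.Pointwise as Pointwise
open import Data.List.Relation.Unary.All using (All; []; _∷_)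
import Data.List.Relation.Unary.All as All
import Data.List.Relation.Unary.All.Properties as All
open import Data.List.Relation.Unary.AllPairs using (AllPairs; []; _∷_)
import Data.List.Relation.Unary.AllPairs.Properties as AllPairs
open import Data.List.Relation.Unary.Any using (here; there)
open import Data.Maybe using (just)
open import Data.Nat using (ℕ; zero; suc; _+_; _≤_; _<_; z≤n; s≤s; _≤?_; _<?_; _≟_)
open import Data.Nat.ListAction using (sum)
open import Data.Nat.ListAction.Properties using (sum-++)
import Data.Nat.Properties as ℕ
open import Data.Nat.Solver using (module +-*-Solver)
open import Data.Product using (Σ-syntax; ∃-syntax; _×_; _,_; proj₁; proj₂)
open import Data.Sum using (_⊎_; inj₁; inj₂; [_,_]) renaming (swap to ⊎-swap)
open import Data.Unit using (⊤; tt)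
open import Function using (_∘_; id)
open import Function.Definitions using (Injective; Bijective)
open import Relation.Binary.Definitions using (Tri; tri<; tri≈; tri>)
open import Relation.Binary.PropositionalEquality using (_≡_; _≢_; refl; sym; trans; cong; cong₂; subst; subst₂; ≢-sym; resp₂; setoid)
open import Relation.Nullary using (¬_; yes; no; does; contradiction)
open import Relation.Unary using (_∪_)
open +-*-Solver using (solve; _:+_; _:=_)

-- Betweenness on a line.

Mid : {A : Set} → (A → A → Set) → A → A → A → Set
Mid _<_ a b c = (a < b × b < c) ⊎ (c < b × b < a)

between-self : ∀ {a p} → Between a p a → p ≡ a
between-self (inj₁ (a≤p , p≤a)) = ℤ.≤-antisym p≤a a≤p
between-self (inj₂ (a≤p , p≤a)) = ℤ.≤-antisym p≤a a≤p

-- The ranges from `b` to `a` and from `b` to `c` extend to opposite sides of `b`. Every claim that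
-- two collinear legs share only their common vertex reduces to this.
between-opposite : ∀ {a b c p} → Mid _<ℤ_ a b c → Between b p a → Between b p c → p ≡ b
between-opposite (inj₁ (a<b , b<c)) (inj₁ (b≤p , p≤a)) _ =
  contradiction (ℤ.≤-trans b≤p p≤a) (ℤ.<⇒≱ a<b)
between-opposite (inj₁ (a<b , b<c)) (inj₂ (a≤p , p≤b)) (inj₁ (b≤p , p≤c)) = ℤ.≤-antisym p≤b b≤p
between-opposite (inj₁ (a<b , b<c)) (inj₂ (a≤p , p≤b)) (inj₂ (c≤p , p≤b′)) =
  contradiction (ℤ.≤-trans c≤p p≤b′) (ℤ.<⇒≱ b<c)
between-opposite (inj₂ (c<b , b<a)) (inj₁ (b≤p , p≤a)) (inj₁ (b≤p′ , p≤c)) =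
  contradiction (ℤ.≤-trans b≤p′ p≤c) (ℤ.<⇒≱ c<b)
between-opposite (inj₂ (c<b , b<a)) (inj₁ (b≤p , p≤a)) (inj₂ (c≤p , p≤b)) = ℤ.≤-antisym p≤b b≤p
between-opposite (inj₂ (c<b , b<a)) (inj₂ (a≤p , p≤b)) _ =
  contradiction (ℤ.≤-trans a≤p p≤b) (ℤ.<⇒≱ b<a)

between-endʳ : ∀ {a b} → Between a b b
between-endʳ {a} {b} with ℤ.≤-total a b
... | inj₁ a≤b = inj₁ (a≤b , ℤ.≤-refl)
... | inj₂ b≤a = inj₂ (ℤ.≤-refl , b≤a)

mid-≢ : ∀ {a b c} → Mid _<ℤ_ a b c → c ≢ b
mid-≢ (inj₁ (_ , b<c)) refl = ℤ.<-irrefl refl b<c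
mid-≢ (inj₂ (c<b , _)) refl = ℤ.<-irrefl refl c<b

-- From L-shaped edges to restricted RAC₁ embeddings.

-- Edge e leaves the vertex hor e horizontally and the vertex ver e vertically.
record LShaped (G : Graph) (p : Fin (V G) → Point) : Set where
  field
    hor ver   : Fin (m G) → Fin (V G)
    ends      : ∀ e → E G e ≡ (hor e , ver e) ⊎ E G e ≡ (ver e , hor e)
    loopless  : ∀ e → hor e ≢ ver e
    hor-split : ∀ {e f} → e ≢ f → hor e ≡ hor f →
                Mid _<ℤ_ (px (p (ver e))) (px (p (hor e))) (px (p (ver f)))
    ver-split : ∀ {e f} → e ≢ f → ver e ≡ ver f →
                Mid _<ℤ_ (py (p (hor e))) (py (p (ver e))) (py (p (hor f)))

module _ (G : Graph) (S : Fin (V G) → Point) (grid : GridPointSet (V G) S)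
         (μ : Fin (V G) → Fin (V G)) (μ-bij : Bijective _≡_ _≡_ μ)
         (L : LShaped G (S ∘ μ)) where

  open LShaped L

  private
    p : Fin (V G) → Point
    p = S ∘ μ

    px-injective : ∀ {u v} → px (p u) ≡ px (p v) → u ≡ v
    px-injective {u} {v} eq with u ≟ᶠ v
    ... | yes u≡v = u≡v
    ... | no  u≢v = contradiction eq (proj₁ (proj₂ grid _ _ (u≢v ∘ proj₁ μ-bij)))

    py-injective : ∀ {u v} → py (p u) ≡ py (p v) → u ≡ v
    py-injective {u} {v} eq with u ≟ᶠ v
    ... | yes u≡v = u≡v
    ... | no  u≢v = contradiction eq (proj₂ (proj₂ grid _ _ (u≢v ∘ proj₁ μ-bij)))

    corner : Fin (m G) → Point
    corner e = px (p (ver e)) , py (p (hor e))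

    -- Segments are taken up to reversal, since `E` may list the horizontal end of an edge first or
    -- second.
    Joins : Point → Point → Segment → Set
    Joins A B s = s ≡ (A , B) ⊎ s ≡ (B , A)

    HSeg VSeg : Fin (m G) → Segment → Set
    HSeg e = Joins (p (hor e)) (corner e)
    VSeg e = Joins (p (ver e)) (corner e)

    legs : ∀ e {s} → s ∈ polySegs (p (proj₁ (E G e))) (just (corner e)) (p (proj₂ (E G e))) →
           HSeg e s ⊎ VSeg e s
    legs e s∈ with E G e | ends e
    legs e (here eq)         | _ | inj₁ refl = inj₁ (inj₁ eq)
    legs e (there (here eq)) | _ | inj₁ refl = inj₂ (inj₂ eq)
    legs e (here eq)         | _ | inj₂ refl = inj₂ (inj₁ eq)
    legs e (there (here eq)) | _ | inj₂ refl = inj₁ (inj₂ eq)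

    onJoin : ∀ {A B s P} → Joins A B s → OnSeg P s → OnSeg P (A , B)
    onJoin (inj₁ refl) on        = on
    onJoin (inj₂ refl) (bx , by) = ⊎-swap bx , ⊎-swap by

    interiorJoin : ∀ {A B s P} → Joins A B s → OnSeg P s → P ≢ A → P ≢ B → Interior P s
    interiorJoin (inj₁ refl) on P≢A P≢B = on , P≢A , P≢B
    interiorJoin (inj₂ refl) on P≢A P≢B = on , P≢B , P≢A

    corner≢hor : ∀ e → p (hor e) ≢ corner e
    corner≢hor e eq = loopless e (px-injective (cong px eq))

    corner≢ver : ∀ e → p (ver e) ≢ corner e
    corner≢ver e eq = loopless e (sym (py-injective (cong py eq)))

    HSeg-horizontal : ∀ {e s} → HSeg e s → Horizontal s
    HSeg-horizontal (inj₁ refl) = refl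
    HSeg-horizontal (inj₂ refl) = refl

    VSeg-vertical : ∀ {e s} → VSeg e s → Vertical s
    VSeg-vertical (inj₁ refl) = refl
    VSeg-vertical (inj₂ refl) = refl

    joins-≢ : ∀ {A B s} → A ≢ B → Joins A B s → proj₁ s ≢ proj₂ s
    joins-≢ A≢B (inj₁ refl) = A≢B
    joins-≢ A≢B (inj₂ refl) = ≢-sym A≢B

    hor-end : ∀ e → hor e ≡ proj₁ (E G e) ⊎ hor e ≡ proj₂ (E G e)
    hor-end e with E G e | ends e
    ... | _ | inj₁ refl = inj₁ refl
    ... | _ | inj₂ refl = inj₂ refl

    ver-end : ∀ e → ver e ≡ proj₁ (E G e) ⊎ ver e ≡ proj₂ (E G e)
    ver-end e with E G e | ends e
    ... | _ | inj₁ refl = inj₂ refl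
    ... | _ | inj₂ refl = inj₁ refl

    Meets : Fin (m G) → Fin (m G) → Segment → Segment → Point → Set
    Meets e f s t P =
      (Σ[ w ∈ Fin (V G) ] (w ≡ proj₁ (E G e) ⊎ w ≡ proj₂ (E G e)) ×
                          (w ≡ proj₁ (E G f) ⊎ w ≡ proj₂ (E G f)) × P ≡ p w)
      ⊎ (Perp s t × Interior P s × Interior P t)

    meets-sym : ∀ {e f s t P} → Meets e f s t P → Meets f e t s P
    meets-sym (inj₁ (w , we , wf , eq))        = inj₁ (w , wf , we , eq)
    meets-sym (inj₂ (inj₁ (hs , vt) , is , it)) = inj₂ (inj₂ (vt , hs) , it , is)
    meets-sym (inj₂ (inj₂ (vs , ht) , is , it)) = inj₂ (inj₁ (ht , vs) , it , is)

    -- Horizontal legs with a common point lie in one row. No row holds two points of the set, so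
    -- both legs start at the same vertex, where they leave to opposite sides.
    meets-HH : ∀ {e f s t P} → e ≢ f → HSeg e s → HSeg f t → OnSeg P s → OnSeg P t →
               Meets e f s t P
    meets-HH {e} {f} {P = P} e≢f hs ht Ps Pt with onJoin hs Ps | onJoin ht Pt
    ... | xs , ys | xt , yt = inj₁ (hor e , hor-end e , subst (λ w → w ≡ _ ⊎ w ≡ _) (sym same) (hor-end f) ,
            cong₂ _,_ (between-opposite (hor-split e≢f same) xs
                        (subst (λ w → Between (px (p w)) (px P) _) (sym same) xt))
                      (between-self ys))
      where
      same : hor e ≡ hor f
      same = py-injective (trans (sym (between-self ys)) (between-self yt))

    meets-VV : ∀ {e f s t P} → e ≢ f → VSeg e s → VSeg f t → OnSeg P s → OnSeg P t →
               Meets e f s t P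
    meets-VV {e} {f} {P = P} e≢f vs vt Ps Pt with onJoin vs Ps | onJoin vt Pt
    ... | xs , ys | xt , yt = inj₁ (ver e , ver-end e , subst (λ w → w ≡ _ ⊎ w ≡ _) (sym same) (ver-end f) ,
            cong₂ _,_ (between-self xs)
                      (between-opposite (ver-split e≢f same) ys
                        (subst (λ w → Between (py (p w)) (py P) _) (sym same) yt)))
      where
      same : ver e ≡ ver f
      same = px-injective (trans (sym (between-self xs)) (between-self xt))

    -- A common point has the column of `ver f` and the row of `hor e`. If these are one vertex, the
    -- edges meet there; otherwise the point is neither a vertex nor a bend of the two legs, so the
    -- crossing is proper.
    meets-HV : ∀ {e f s t P} → e ≢ f → HSeg e s → VSeg f t → OnSeg P s → OnSeg P t →
               Meets e f s t P
    meets-HV {e} {f} {P = P} e≢f hs vt Ps Pt with onJoin hs Ps | onJoin vt Pt | hor e ≟ᶠ ver f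
    ... | xs , ys | xt , yt | yes he≡vf =
      inj₁ (hor e , hor-end e , subst (λ w → w ≡ _ ⊎ w ≡ _) (sym he≡vf) (ver-end f) ,
            cong₂ _,_ (trans (between-self xt) (cong (px ∘ p) (sym he≡vf))) (between-self ys))
    ... | xs , ys | xt , yt | no he≢vf =
      inj₂ (inj₁ (HSeg-horizontal {e} hs , VSeg-vertical {f} vt) ,
            interiorJoin hs Ps
              (λ eq → he≢vf (px-injective (trans (sym (cong px eq)) Px)))
              (λ eq → ¬corner-e (px-injective (trans (sym (cong px eq)) Px))) ,
            interiorJoin vt Pt
              (λ eq → he≢vf (py-injective (trans (sym Py) (cong py eq))))
              (λ eq → ¬corner-f (py-injective (trans (sym Py) (cong py eq)))))
      where
      Px : px P ≡ px (p (ver f))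
      Px = between-self xt
      Py : py P ≡ py (p (hor e))
      Py = between-self ys
      -- If `P` were the bend of `e`, both edges would leave `ver e` vertically, to opposite sides,
      -- so `P` would be in the row of `ver e`; but its row is that of `hor e`. `¬corner-f` is the
      -- same argument for the horizontal legs at `hor e`.
      ¬corner-e : ver e ≢ ver f
      ¬corner-e same = loopless e (py-injective (trans (sym Py)
        (between-opposite (ver-split e≢f same)
          (subst (λ c → Between _ c _) (sym Py) between-endʳ)
          (subst (λ w → Between (py (p w)) (py P) _) (sym same) yt))))
      ¬corner-f : hor e ≢ hor f
      ¬corner-f same = mid-≢ (hor-split e≢f same) (trans (sym Px)
        (between-opposite (hor-split e≢f same) xs
          (subst (λ c → Between _ c _) (sym Px) between-endʳ)))

  lShaped⇒RAC₁ : RestrictedRAC₁ G S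
  lShaped⇒RAC₁ = record
    { μ         = μ
    ; μ-bij     = μ-bij
    ; bend      = λ e → just (corner e)
    ; axis      = λ e s s∈ → axis′ e (legs e s∈)
    ; bend-perp = λ { e _ refl → perp e }
    ; avoid     = λ e w w≢src w≢tgt s s∈ → avoid′ e w w≢src w≢tgt (legs e s∈)
    ; crossing  = λ e f e≢f s t s∈ t∈ P → crossing′ e≢f (legs e s∈) (legs f t∈)
    }
    where
    axis′ : ∀ e {s} → HSeg e s ⊎ VSeg e s → AxisSeg s
    axis′ e (inj₁ hs) = inj₁ (HSeg-horizontal {e} hs) , joins-≢ (corner≢hor e) hs
    axis′ e (inj₂ vs) = inj₂ (VSeg-vertical {e} vs) , joins-≢ (corner≢ver e) vs

    perp : ∀ e → Perp (p (proj₁ (E G e)) , corner e) (corner e , p (proj₂ (E G e)))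
    perp e with E G e | ends e
    ... | _ | inj₁ refl = inj₁ (refl , refl)
    ... | _ | inj₂ refl = inj₂ (refl , refl)

    avoid′ : ∀ e w → w ≢ proj₁ (E G e) → w ≢ proj₂ (E G e) → ∀ {s} → HSeg e s ⊎ VSeg e s →
             ¬ OnSeg (p w) s
    avoid′ e w w≢src w≢tgt (inj₁ hs) on with py-injective {w} (between-self (proj₂ (onJoin hs on))) | hor-end e
    ... | refl | inj₁ eq = w≢src eq
    ... | refl | inj₂ eq = w≢tgt eq
    avoid′ e w w≢src w≢tgt (inj₂ vs) on with px-injective {w} (between-self (proj₁ (onJoin vs on))) | ver-end e
    ... | refl | inj₁ eq = w≢src eq
    ... | refl | inj₂ eq = w≢tgt eq

    crossing′ : ∀ {e f} → e ≢ f → ∀ {s t P} → HSeg e s ⊎ VSeg e s → HSeg f t ⊎ VSeg f t →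
                OnSeg P s → OnSeg P t → Meets e f s t P
    crossing′ e≢f (inj₁ hs) (inj₁ ht) Ps Pt = meets-HH e≢f hs ht Ps Pt
    crossing′ e≢f (inj₁ hs) (inj₂ vt) Ps Pt = meets-HV e≢f hs vt Ps Pt
    crossing′ e≢f (inj₂ vs) (inj₁ ht) Ps Pt = meets-sym (meets-HV (≢-sym e≢f) ht vs Pt Ps)
    crossing′ e≢f (inj₂ vs) (inj₂ vt) Ps Pt = meets-VV e≢f vs vt Ps Pt

-- Cyclic order, and placements of vertices in columns.

mid-sym : {A : Set} {_<_ : A → A → Set} {a b c : A} → Mid _<_ a b c → Mid _<_ c b a
mid-sym = ⊎-swap

Window : ℕ → ℕ → ℕ → Set
Window lo hi c = lo ≤ c × c < hi

prv : ∀ {p} → Fin (suc p) → Fin (suc p)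
prv {p} zero = fromℕ p
prv (suc i)  = inject₁ i

abstract
  -- Later arguments use only that `nxt` and `prv` are mutually inverse, so the case distinction is
  -- kept from unfolding.
  nxt : ∀ {p} → Fin (suc p) → Fin (suc p)
  nxt {p} i with p ≟ toℕ i
  ... | yes _  = zero
  ... | no p≢i = suc (lower₁ i p≢i)

  prv-nxt : ∀ {p} (i : Fin (suc p)) → prv (nxt i) ≡ i
  prv-nxt {p} i with p ≟ toℕ i
  ... | yes p≡i = Fin.toℕ-injective (trans (Fin.toℕ-fromℕ p) p≡i)
  ... | no  p≢i = Fin.inject₁-lower₁ i p≢i

prv-injective : ∀ {p} {i i′ : Fin (suc p)} → prv i ≡ prv i′ → i ≡ i′
prv-injective {_} {zero}  {zero}   eq = refl
prv-injective {_} {zero}  {suc i′} eq = contradiction eq Fin.fromℕ≢inject₁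
prv-injective {_} {suc i} {zero}   eq = contradiction (sym eq) Fin.fromℕ≢inject₁
prv-injective {_} {suc i} {suc i′} eq = cong suc (Fin.inject₁-injective eq)

nxt-prv : ∀ {p} (i : Fin (suc p)) → nxt (prv i) ≡ i
nxt-prv i = prv-injective (prv-nxt (prv i))

prv≢id : ∀ {p} (i : Fin (2 + p)) → prv i ≢ i
prv≢id (suc i) eq = ℕ.1+n≢n (trans (sym (cong toℕ eq)) (Fin.toℕ-inject₁ i))

prv²≢id : ∀ {p} (i : Fin (3 + p)) → prv (prv i) ≢ i
prv²≢id zero          ()
prv²≢id (suc zero)    ()
prv²≢id (suc (suc i)) eq =
  ℕ.m≢1+n+m (toℕ i) {1} (trans (sym (trans (Fin.toℕ-inject₁ _) (Fin.toℕ-inject₁ i))) (cong toℕ eq))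

-- This is where four vertices differ from three: the two neighbours of a vertex are not joined to
-- each other.
prv³≢id : ∀ {p} (i : Fin (4 + p)) → prv (prv (prv i)) ≢ i
prv³≢id zero                ()
prv³≢id (suc zero)          ()
prv³≢id (suc (suc zero))    ()
prv³≢id (suc (suc (suc i))) eq =
  ℕ.m≢1+n+m (toℕ i) {2}
    (trans (sym (trans (Fin.toℕ-inject₁ _) (trans (Fin.toℕ-inject₁ _) (Fin.toℕ-inject₁ i)))) (cong toℕ eq))

-- Indexing each edge by its second end turns properties of the edge list into properties of single
-- vertices.
cycleEdges-tabulate : ∀ p → cycleEdges p ≡ tabulate (λ v → prv v , v)
cycleEdges-tabulate p = cong ((fromℕ p , zero) ∷_) (map-tabulate id (λ i → inject₁ i , suc i))

record Placement (n : ℕ) (W : ℕ → Set) : Set where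
  field
    col       : Fin n → ℕ
    injective : ∀ {u v} → col u ≡ col v → u ≡ v
    window    : ∀ v → W (col v)
open Placement public

swapℕ : ℕ → ℕ → ℕ → ℕ
swapℕ p q x with x ≟ p
... | yes _ = q
... | no  _ with x ≟ q
...   | yes _ = p
...   | no  _ = x

swapℕ-left : ∀ p q → swapℕ p q p ≡ q
swapℕ-left p q with p ≟ p
... | yes _ = refl
... | no p≢p = contradiction refl p≢p

swapℕ-fixed : ∀ {p q x} → x ≢ p → x ≢ q → swapℕ p q x ≡ x
swapℕ-fixed {p} {q} {x} x≢p x≢q with x ≟ p
... | yes x≡p = contradiction x≡p x≢p
... | no  _ with x ≟ q
...   | yes x≡q = contradiction x≡q x≢q
...   | no  _   = refl

swapℕ-injective : ∀ p q {x x′} → swapℕ p q x ≡ swapℕ p q x′ → x ≡ x′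
swapℕ-injective p q {x} {x′} eq with x ≟ p | x′ ≟ p
... | yes x≡p | yes x′≡p = trans x≡p (sym x′≡p)
... | yes x≡p | no  x′≢p with x′ ≟ q
...   | yes x′≡q = trans x≡p (trans (sym eq) (sym x′≡q))
...   | no  x′≢q = contradiction (sym eq) x′≢q
swapℕ-injective p q {x} {x′} eq | no x≢p | yes x′≡p with x ≟ q
...   | yes x≡q = trans x≡q (trans (sym eq) (sym x′≡p))
...   | no  x≢q = contradiction eq x≢q
swapℕ-injective p q {x} {x′} eq | no x≢p | no x′≢p with x ≟ q | x′ ≟ q
...   | yes x≡q | yes x′≡q = trans x≡q (sym x′≡q)
...   | yes x≡q | no  x′≢q = contradiction (sym eq) x′≢p
...   | no  x≢q | yes x′≡q = contradiction eq x≢p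
...   | no  x≢q | no  x′≢q = eq

swapℕ-preserves : ∀ (P : ℕ → Set) {p q x} → P p → P q → P x → P (swapℕ p q x)
swapℕ-preserves P {p} {q} {x} Pp Pq Px with x ≟ p
... | yes _ = Pq
... | no  _ with x ≟ q
...   | yes _ = Pp
...   | no  _ = Px

-- The values are enforced one at a time. Once the tail is settled, exchanging the current column of
-- `v` with `p` puts `v` in place. Vertices of the tail do not move: their columns differ from `p`
-- by assumption and from the current column of `v` by injectivity.
prescribe : ∀ {n W} → Placement n W → (vs : List (Fin n × ℕ)) →
            AllPairs (λ a b → proj₁ a ≢ proj₁ b × proj₂ a ≢ proj₂ b) vs →
            All (W ∘ proj₂) vs →
            Σ[ ι ∈ Placement n W ] All (λ a → col ι (proj₁ a) ≡ proj₂ a) vs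
prescribe ι []             _            _        = ι , []
prescribe {W = W} ι ((v , p) ∷ vs) (new ∷ dist) (w ∷ ws) with prescribe ι vs dist ws
... | ι′ , fixed = record
  { col       = swapℕ (col ι′ v) p ∘ col ι′
  ; injective = injective ι′ ∘ swapℕ-injective (col ι′ v) p
  ; window    = λ u → swapℕ-preserves W (window ι′ v) w (window ι′ u)
  } , swapℕ-left (col ι′ v) p ∷ All.map
        (λ { ((v≢u , p≢q) , eq) → trans
               (swapℕ-fixed (λ e → v≢u (sym (injective ι′ e))) (λ e → p≢q (trans (sym e) eq))) eq })
        (All.zip (new , fixed))

shift : ∀ n o → Placement n (Window o (n + o))
shift n o = record
  { col       = λ v → toℕ v + o
  ; injective = λ eq → Fin.toℕ-injective (ℕ.+-cancelʳ-≡ o _ _ eq)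
  ; window    = λ v → ℕ.m≤n+m o (toℕ v) , ℕ.+-monoˡ-< o (Fin.toℕ<n v)
  }

-- Attachment vertices and unions of placements.

fresh : ∀ {j} (u v : Fin (3 + j)) → Σ[ w ∈ Fin (3 + j) ] w ≢ u × w ≢ v
fresh zero          zero          = suc zero , (λ ()) , λ ()
fresh zero          (suc zero)    = suc (suc zero) , (λ ()) , λ ()
fresh zero          (suc (suc _)) = suc zero , (λ ()) , λ ()
fresh (suc zero)    zero          = suc (suc zero) , (λ ()) , λ ()
fresh (suc (suc _)) zero          = suc zero , (λ ()) , λ ()
fresh (suc _)       (suc _)       = zero , (λ ()) , λ ()

-- The condition under which `b` can receive the edge from the parent: its other edges all belong to
-- the cycle.
FreeRoot : ∀ {k} → CycTree k → Fin k → Set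
FreeRoot (node j none)               b = ⊤
FreeRoot (node j (one a _ _))        b = b ≢ a
FreeRoot (node j (two a _ _ a′ _ _)) b = b ≢ a × b ≢ a′

-- What the degree bound says about the attachment vertices of each cycle.
DistinctPorts : ∀ {k} → CycTree k → Set
DistinctPorts (node j none)                 = ⊤
DistinctPorts (node j (one a b c))          = DistinctPorts c × FreeRoot c b
DistinctPorts (node j (two a b c a′ b′ c′)) =
  a ≢ a′ × (DistinctPorts c × FreeRoot c b) × (DistinctPorts c′ × FreeRoot c′ b′)

Disjoint : (W W′ : ℕ → Set) → Set
Disjoint W W′ = ∀ {c c′} → W c → W′ c′ → c ≢ c′

disjoint-sym : ∀ {W W′} → Disjoint W W′ → Disjoint W′ W
disjoint-sym disj c∈ c′∈ eq = disj c′∈ c∈ (sym eq)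

module _ {m n : ℕ} {W W′ : ℕ → Set} (ι : Placement m W) (ι′ : Placement n W′) (disj : Disjoint W W′) where

  private
    col⊎ : Fin m ⊎ Fin n → ℕ
    col⊎ = [ col ι , col ι′ ]

    injective⊎ : ∀ u v → col⊎ u ≡ col⊎ v → u ≡ v
    injective⊎ (inj₁ u) (inj₁ v) eq = cong inj₁ (injective ι eq)
    injective⊎ (inj₁ u) (inj₂ v) eq = contradiction eq (disj (window ι u) (window ι′ v))
    injective⊎ (inj₂ u) (inj₁ v) eq = contradiction (sym eq) (disj (window ι v) (window ι′ u))
    injective⊎ (inj₂ u) (inj₂ v) eq = cong inj₂ (injective ι′ eq)

    window⊎ : ∀ u → W (col⊎ u) ⊎ W′ (col⊎ u)
    window⊎ (inj₁ u) = inj₁ (window ι u)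
    window⊎ (inj₂ u) = inj₂ (window ι′ u)

  union : Placement (m + n) (W ∪ W′)
  union = record
    { col       = col⊎ ∘ splitAt m
    ; injective = λ {u} {v} eq → trans (sym (Fin.join-splitAt m n u))
                    (trans (cong (join m n) (injective⊎ (splitAt m u) (splitAt m v) eq)) (Fin.join-splitAt m n v))
    ; window    = window⊎ ∘ splitAt m
    }

  union-ˡ : ∀ u → col union (u ↑ˡ n) ≡ col ι u
  union-ˡ u = cong col⊎ (Fin.splitAt-↑ˡ m u n)

  union-ʳ : ∀ v → col union (m ↑ʳ v) ≡ col ι′ v
  union-ʳ v = cong col⊎ (Fin.splitAt-↑ʳ m n v)

widen : ∀ {n W W′} → (∀ {c} → W c → W′ c) → Placement n W → Placement n W′
widen W⊆W′ ι = record { col = col ι ; injective = injective ι ; window = W⊆W′ ∘ window ι }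

window-disjoint : ∀ {lo mid mid′ hi} → mid ≤ mid′ → Disjoint (Window lo mid) (Window mid′ hi)
window-disjoint mid≤mid′ (_ , c<mid) (mid′≤c , _) refl = ℕ.<⇒≱ c<mid (ℕ.≤-trans mid≤mid′ mid′≤c)

-- Layouts described by columns and their heights.

module Columns (y : ℕ → ℤ) (y-injective : Injective _≡_ _≡_ y) where

  infix 4 _≺_
  -- Points are named by their columns, so the horizontal order is that of the natural numbers and
  -- the vertical order is induced by `y`.
  _≺_ : ℕ → ℕ → Set
  i ≺ j = y i <ℤ y j

  ≺-connex : ∀ {i j} → i ≢ j → i ≺ j ⊎ j ≺ i
  ≺-connex {i} {j} i≢j with ℤ.<-cmp (y i) (y j)
  ... | tri< i≺j _ _ = inj₁ i≺j
  ... | tri≈ _ eq _  = contradiction (y-injective eq) i≢j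
  ... | tri> _ _ j≺i = inj₂ j≺i

  -- (h , v) stands for the edge leaving column h horizontally and column v vertically.
  Compat : ℕ × ℕ → ℕ × ℕ → Set
  Compat (h , v) (h′ , v′) = (h ≡ h′ → Mid _<_ v h v′) × (v ≡ v′ → Mid _≺_ h v h′)

  compat-sym : ∀ {d d′} → Compat d d′ → Compat d′ d
  compat-sym {h , v} {h′ , v′} (hor , ver) =
    (λ { refl → mid-sym {_<_ = _<_} (hor refl) }) , (λ { refl → mid-sym {_<_ = _≺_} (ver refl) })

  Drawn : ∀ {n} → (Fin n → ℕ) → Fin n × Fin n → ℕ × ℕ → Set
  Drawn col (u , v) d = d ≡ (col u , col v) ⊎ d ≡ (col v , col u)

  -- Directed edges carry columns instead of vertices, so the list for a subtree is unchanged when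
  -- its vertices are renumbered inside a larger tree.
  record Layout {n : ℕ} (es : List (Fin n × Fin n)) (W : ℕ → Set) : Set where
    field
      placement : Placement n W
      directed  : List (ℕ × ℕ)
      drawn     : Pointwise (Drawn (col placement)) es directed
      compat    : AllPairs Compat directed
  open Layout public

  -- A further edge at column c, leaving it vertically towards the height of
  -- column q, respectively horizontally to the left or right, is compatible
  -- with the given edges.
  FreeTowards : ℕ → ℕ → List (ℕ × ℕ) → Set
  FreeTowards q c = All (λ d → proj₂ d ≡ c → Mid _≺_ (proj₁ d) c q)

  FreeLeft FreeRight : ℕ → List (ℕ × ℕ) → Set
  FreeLeft  c = All (λ d → proj₁ d ≡ c → c < proj₂ d)
  FreeRight c = All (λ d → proj₁ d ≡ c → proj₂ d < c)

  -- `b` awaits the edge to the parent's vertex in column `q`, while `l` and `r` await edges to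
  -- children placed to the left and to the right.
  record CycleLayout {p : ℕ} (b l r : Fin (suc p)) (W : ℕ → Set) (q : ℕ) : Set where
    field
      layout : Layout (cycleEdges p) W
      bFree  : FreeTowards q (col (placement layout) b) (directed layout)
      lFree  : FreeLeft (col (placement layout) l) (directed layout)
      rFree  : FreeRight (col (placement layout) r) (directed layout)

  module DirectedCycle {p : ℕ} {b l r : Fin (suc p)} {W : ℕ → Set} {q : ℕ} (ι : Placement (suc p) W) where

    -- The cycle is traversed by f, with inverse g; each vertex is left
    -- horizontally towards its f-neighbour and vertically towards its g-neighbour.
    record Good (f g : Fin (suc p) → Fin (suc p)) : Set where
      field
        b-ok : Mid _≺_ (col ι (g b)) (col ι b) q
        l-ok : col ι l < col ι (f l)
        r-ok : col ι (f r) < col ι r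

    private
      cycleLayout : (d : Fin (suc p) → ℕ × ℕ) → (∀ v → Drawn (col ι) (prv v , v) (d v)) →
                    (∀ {u v} → proj₁ (d u) ≡ proj₁ (d v) → u ≡ v) →
                    (∀ {u v} → proj₂ (d u) ≡ proj₂ (d v) → u ≡ v) →
                    (∀ v → proj₂ (d v) ≡ col ι b → Mid _≺_ (proj₁ (d v)) (col ι b) q) →
                    (∀ v → proj₁ (d v) ≡ col ι l → col ι l < proj₂ (d v)) →
                    (∀ v → proj₁ (d v) ≡ col ι r → proj₂ (d v) < col ι r) →
                    CycleLayout b l r W q
      cycleLayout d dr hor-inj ver-inj fb fl fr = record
        { layout = record
          { placement = ι
          ; directed  = tabulate d
          ; drawn     = subst (λ es → Pointwise (Drawn (col ι)) es (tabulate d))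
                          (sym (cycleEdges-tabulate p)) (Pointwise.tabulate⁺ dr)
          -- Each vertex is left horizontally by one edge and vertically by one, so no two edges
          -- compete for a direction.
          ; compat    = AllPairs.tabulate⁺ λ u≢v →
                          (λ eq → contradiction (hor-inj eq) u≢v) , (λ eq → contradiction (ver-inj eq) u≢v)
          }
        ; bFree = All.tabulate⁺ fb
        ; lFree = All.tabulate⁺ fl
        ; rFree = All.tabulate⁺ fr
        }

      prv-≡ : ∀ {u v : Fin (suc p)} → col ι (prv u) ≡ col ι v → u ≡ nxt v
      prv-≡ eq = prv-injective (trans (injective ι eq) (sym (prv-nxt _)))

    forward : Good nxt prv → CycleLayout b l r W q
    forward good = cycleLayout (λ v → col ι (prv v) , col ι v) (λ _ → inj₁ refl)
      (λ eq → prv-injective (injective ι eq)) (injective ι)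
      (λ v eq → subst (λ u → Mid _≺_ (col ι (prv u)) (col ι b) q) (sym (injective ι eq)) b-ok)
      (λ v eq → subst (λ u → col ι l < col ι u) (sym (prv-≡ eq)) l-ok)
      (λ v eq → subst (λ u → col ι u < col ι r) (sym (prv-≡ eq)) r-ok)
      where open Good good

    backward : Good prv nxt → CycleLayout b l r W q
    backward good = cycleLayout (λ v → col ι v , col ι (prv v)) (λ _ → inj₂ refl)
      (injective ι) (λ eq → prv-injective (injective ι eq))
      (λ v eq → subst (λ u → Mid _≺_ (col ι u) (col ι b) q) (sym (prv-≡ eq)) b-ok)
      (λ v eq → subst (λ u → col ι l < col ι (prv u)) (sym (injective ι eq)) l-ok)
      (λ v eq → subst (λ u → col ι (prv u) < col ι r) (sym (injective ι eq)) r-ok)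
      where open Good good

  -- Cycles with at least four vertices.

  record Triple (lo P Q T : ℕ) : Set where
    constructor triple
    field
      P≢Q : P ≢ Q
      P≢T : P ≢ T
      Q≢T : Q ≢ T
      P∈  : Window lo (3 + lo) P
      Q∈  : Window lo (3 + lo) Q
      T∈  : Window lo (3 + lo) T
      cover : ∀ {c} → Window lo (3 + lo) c → c ≡ P ⊎ c ≡ Q ⊎ c ≡ T

  swap₁₂ : ∀ {lo P Q T} → Triple lo P Q T → Triple lo Q P T
  swap₁₂ t = triple (≢-sym P≢Q) Q≢T P≢T Q∈ P∈ T∈ (λ w → exchange (cover w))
    where
    open Triple t
    exchange : ∀ {A B C : Set} → A ⊎ B ⊎ C → B ⊎ A ⊎ C
    exchange (inj₁ a)        = inj₂ (inj₁ a)
    exchange (inj₂ (inj₁ b)) = inj₁ b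
    exchange (inj₂ (inj₂ c)) = inj₂ (inj₂ c)

  rotate : ∀ {lo P Q T} → Triple lo P Q T → Triple lo Q T P
  rotate t = triple Q≢T (≢-sym P≢Q) (≢-sym P≢T) Q∈ T∈ P∈ (λ w → rot (cover w))
    where
    open Triple t
    rot : ∀ {A B C : Set} → A ⊎ B ⊎ C → B ⊎ C ⊎ A
    rot (inj₁ a)        = inj₂ (inj₂ a)
    rot (inj₂ (inj₁ b)) = inj₁ b
    rot (inj₂ (inj₂ c)) = inj₂ (inj₁ c)

  consecutive : ∀ lo → Triple lo lo (1 + lo) (2 + lo)
  consecutive lo = triple
    (λ ()) (λ ()) (λ ())
    (ℕ.≤-refl , ℕ.m≤n+m (1 + lo) 2)
    (ℕ.n≤1+n lo , ℕ.n≤1+n (2 + lo))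
    (ℕ.m≤n+m lo 2 , ℕ.≤-refl)
    λ {c} → cover c
    where
    cover : ∀ c → Window lo (3 + lo) c → c ≡ lo ⊎ c ≡ 1 + lo ⊎ c ≡ 2 + lo
    cover c (lo≤c , s≤s c≤) with c ≟ lo | c ≟ 1 + lo
    ... | yes eq | _      = inj₁ eq
    ... | no _   | yes eq = inj₂ (inj₁ eq)
    ... | no ≢0  | no ≢1  = inj₂ (inj₂ (ℕ.≤-antisym c≤
                              (ℕ.≤∧≢⇒< (ℕ.≤∧≢⇒< lo≤c (≢-sym ≢0)) (≢-sym ≢1))))

  -- The three consecutive columns are taken in an order dictated by their heights: `P` is meant for
  -- `b`, `Q` for the neighbour that `b` reaches vertically, and `T` for whatever vertex should be
  -- extreme.
  Nested : ℕ → ℕ → Set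
  Nested q lo = ∃[ P ] ∃[ Q ] ∃[ T ] Triple lo P Q T × Mid _≺_ Q P q

  -- Two of three columns lie on the same side of q, vertically.
  nested : ∀ q lo → ¬ Window lo (3 + lo) q → Nested q lo
  nested q lo q∉ with consecutive lo
  ... | t = sides t (side (P∈ t)) (side (Q∈ t)) (side (T∈ t))
    where
    open Triple
    side : ∀ {c} → Window lo (3 + lo) c → c ≺ q ⊎ q ≺ c
    side w = ≺-connex (λ { refl → q∉ w })

    below : ∀ {P Q T} → Triple lo P Q T → P ≺ q → Q ≺ q → Nested q lo
    below t P≺q Q≺q with ≺-connex (P≢Q t)
    ... | inj₁ P≺Q = _ , _ , _ , swap₁₂ t , inj₁ (P≺Q , Q≺q)
    ... | inj₂ Q≺P = _ , _ , _ , t , inj₁ (Q≺P , P≺q)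

    above : ∀ {P Q T} → Triple lo P Q T → q ≺ P → q ≺ Q → Nested q lo
    above t q≺P q≺Q with ≺-connex (P≢Q t)
    ... | inj₁ P≺Q = _ , _ , _ , t , inj₂ (q≺P , P≺Q)
    ... | inj₂ Q≺P = _ , _ , _ , swap₁₂ t , inj₂ (q≺Q , Q≺P)

    sides : ∀ {P Q T} → Triple lo P Q T → P ≺ q ⊎ q ≺ P → Q ≺ q ⊎ q ≺ Q → T ≺ q ⊎ q ≺ T → Nested q lo
    sides t (inj₁ P≺) (inj₁ Q≺) _         = below t P≺ Q≺
    sides t (inj₂ ≺P) (inj₂ ≺Q) _         = above t ≺P ≺Q
    sides t (inj₁ P≺) (inj₂ ≺Q) (inj₁ T≺) = below (rotate (rotate t)) T≺ P≺
    sides t (inj₁ P≺) (inj₂ ≺Q) (inj₂ ≺T) = above (rotate t) ≺Q ≺T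
    sides t (inj₂ ≺P) (inj₁ Q≺) (inj₁ T≺) = below (rotate t) Q≺ T≺
    sides t (inj₂ ≺P) (inj₁ Q≺) (inj₂ ≺T) = above (rotate (rotate t)) ≺T ≺P

  -- The triple fills the first three columns from `lo`, so any other column lies beyond all three.
  -- Hence `l` may stand at `T` as soon as its horizontal neighbour is outside the triple.
  below-rest : ∀ {lo P Q T c} → Triple lo P Q T → lo ≤ c → c ≢ P → c ≢ Q → c ≢ T → T < c
  below-rest {lo} {c = c} t lo≤c c≢P c≢Q c≢T with c <? 3 + lo
  ... | no  c≮ = ℕ.<-≤-trans (proj₂ (Triple.T∈ t)) (ℕ.≮⇒≥ c≮)
  ... | yes c< with Triple.cover t (lo≤c , c<)
  ...   | inj₁ c≡P        = contradiction c≡P c≢P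
  ...   | inj₂ (inj₁ c≡Q) = contradiction c≡Q c≢Q
  ...   | inj₂ (inj₂ c≡T) = contradiction c≡T c≢T

  above-rest : ∀ {lo P Q T c} → Triple lo P Q T → c < 3 + lo → c ≢ P → c ≢ Q → c ≢ T → c < T
  above-rest {lo} {c = c} t c< c≢P c≢Q c≢T with lo ≤? c
  ... | no  lo≰c = ℕ.<-≤-trans (ℕ.≰⇒> lo≰c) (proj₁ (Triple.T∈ t))
  ... | yes lo≤c with Triple.cover t (lo≤c , c<)
  ...   | inj₁ c≡P        = contradiction c≡P c≢P
  ...   | inj₂ (inj₁ c≡Q) = contradiction c≡Q c≢Q
  ...   | inj₂ (inj₂ c≡T) = contradiction c≡T c≢T

  module LongCycle (j o q : ℕ) (q∉ : ¬ Window o (4 + j + o) q)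
                   {b l r : Fin (4 + j)} (b≢l : b ≢ l) (b≢r : b ≢ r) (l≢r : l ≢ r) where

    private
      w hi last : ℕ
      -- A `low` triple is the first three columns of the window, a `high` triple, starting at
      -- `1 + w`, the last three. With at least four columns, `last` lies outside the former and `o`
      -- outside the latter.
      w    = j + o
      hi   = 4 + w
      last = 3 + w

      o≤w : o ≤ w
      o≤w = ℕ.m≤n+m o j

      base : Placement (4 + j) (Window o hi)
      base = shift (4 + j) o

      module _ {c : ℕ} where
        low : Window o (3 + o) c → Window o hi c
        low (o≤c , c<) = o≤c , ℕ.<-≤-trans c< (ℕ.≤-trans (ℕ.+-monoʳ-≤ 3 o≤w) (ℕ.n≤1+n last))

        high : Window (1 + w) (4 + w) c → Window o hi c
        high (w<c , c<) = ℕ.≤-trans o≤w (ℕ.<⇒≤ w<c) , c<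

        low≢last : Window o (3 + o) c → c ≢ last
        low≢last (_ , c<) refl = ℕ.<⇒≱ c< (ℕ.+-monoʳ-≤ 3 o≤w)

        high≢o : Window (1 + w) (4 + w) c → c ≢ o
        high≢o (w<c , _) refl = ℕ.<⇒≱ w<c o≤w

        <last : Window o hi c → c ≢ last → c < last
        <last (_ , s≤s c≤) c≢ = ℕ.≤∧≢⇒< c≤ c≢

      last∈ : Window o hi last
      last∈ = ℕ.≤-trans o≤w (ℕ.m≤n+m w 3) , ℕ.≤-refl

      o∈ : Window o hi o
      o∈ = ℕ.≤-refl , s≤s (ℕ.≤-trans o≤w (ℕ.m≤n+m w 3))

    Result : (f g : Fin (4 + j) → Fin (4 + j)) → Set
    Result f g = Σ[ ι ∈ Placement (4 + j) (Window o hi) ] DirectedCycle.Good {b = b} {l} {r} {q = q} ι f g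

    module Traversal (f g : Fin (4 + j) → Fin (4 + j)) (g∘f : ∀ v → g (f v) ≡ v) (f∘g : ∀ v → f (g v) ≡ v)
                     (f≢id : ∀ v → f v ≢ v) (g≢id : ∀ v → g v ≢ v) where

      private
        differ : (ι : Placement (4 + j) (Window o hi)) → ∀ {u v c} → col ι v ≡ c → u ≢ v → col ι u ≢ c
        differ ι eq u≢v eq′ = u≢v (injective ι (trans eq′ (sym eq)))

      -- If `f l` is not `g b`, it avoids the columns of `b`, `g b` and `l`, so these fill a low
      -- triple and `r` goes last. If `f l` is `g b`, then `f r` is not, as `f` is injective, and
      -- the mirror image works: `r` joins a high triple and `l` goes first.
      unmarkedNeighbour : g b ≢ l → g b ≢ r → Result f g
      unmarkedNeighbour gb≢l gb≢r with f l ≟ᶠ g b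
      ... | no fl≢gb = let (P , Q , T , t , mid) = nested q o (q∉ ∘ low) in leftTriple t mid
        where
        leftTriple : ∀ {P Q T} → Triple o P Q T → Mid _≺_ Q P q → Result f g
        leftTriple {P} {Q} {T} t mid = build (prescribe base ((b , P) ∷ (g b , Q) ∷ (l , T) ∷ (r , last) ∷ [])
            (((≢-sym (g≢id b) , P≢Q) ∷ (b≢l , P≢T) ∷ (b≢r , low≢last P∈) ∷ []) ∷
             ((gb≢l , Q≢T) ∷ (gb≢r , low≢last Q∈) ∷ []) ∷ ((l≢r , low≢last T∈) ∷ []) ∷ [] ∷ [])
            (low P∈ ∷ low Q∈ ∷ low T∈ ∷ last∈ ∷ []))
          where
          open Triple t
          build : Σ[ ι ∈ Placement (4 + j) (Window o hi) ] All (λ a → col ι (proj₁ a) ≡ proj₂ a)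
                    ((b , P) ∷ (g b , Q) ∷ (l , T) ∷ (r , last) ∷ []) → Result f g
          build (ι , b≡ ∷ gb≡ ∷ l≡ ∷ r≡ ∷ []) = ι , record
            { b-ok = subst₂ (λ Q P → Mid _≺_ Q P q) (sym gb≡) (sym b≡) mid
            ; l-ok = subst (_< col ι (f l)) (sym l≡)
                       (below-rest t (proj₁ (window ι (f l)))
                         (differ ι b≡ (λ fl≡b → gb≢l (trans (cong g (sym fl≡b)) (g∘f l))))
                         (differ ι gb≡ fl≢gb) (differ ι l≡ (f≢id l)))
            ; r-ok = subst (col ι (f r) <_) (sym r≡) (<last (window ι (f r)) (differ ι r≡ (f≢id r)))
            }
      ... | yes fl≡gb = let (P , Q , T , t , mid) = nested q (1 + w) (q∉ ∘ high) in rightTriple t mid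
        where
        rightTriple : ∀ {P Q T} → Triple (1 + w) P Q T → Mid _≺_ Q P q → Result f g
        rightTriple {P} {Q} {T} t mid = build (prescribe base ((b , P) ∷ (g b , Q) ∷ (r , T) ∷ (l , o) ∷ [])
            (((≢-sym (g≢id b) , P≢Q) ∷ (b≢r , P≢T) ∷ (b≢l , high≢o P∈) ∷ []) ∷
             ((gb≢r , Q≢T) ∷ (gb≢l , high≢o Q∈) ∷ []) ∷ ((≢-sym l≢r , high≢o T∈) ∷ []) ∷ [] ∷ [])
            (high P∈ ∷ high Q∈ ∷ high T∈ ∷ o∈ ∷ []))
          where
          open Triple t
          build : Σ[ ι ∈ Placement (4 + j) (Window o hi) ] All (λ a → col ι (proj₁ a) ≡ proj₂ a)
                    ((b , P) ∷ (g b , Q) ∷ (r , T) ∷ (l , o) ∷ []) → Result f g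
          build (ι , b≡ ∷ gb≡ ∷ r≡ ∷ l≡ ∷ []) = ι , record
            { b-ok = subst₂ (λ Q P → Mid _≺_ Q P q) (sym gb≡) (sym b≡) mid
            ; l-ok = subst (_< col ι (f l)) (sym l≡)
                       (ℕ.≤∧≢⇒< (proj₁ (window ι (f l))) (≢-sym (differ ι l≡ (f≢id l))))
            ; r-ok = subst (col ι (f r) <_) (sym r≡)
                       (above-rest t (proj₂ (window ι (f r)))
                         (differ ι b≡ (λ fr≡b → gb≢r (trans (cong g (sym fr≡b)) (g∘f r))))
                         (differ ι gb≡ (λ fr≡gb → l≢r (trans (sym (g∘f l))
                            (trans (cong g (trans fl≡gb (sym fr≡gb))) (g∘f r)))))
                         (differ ι r≡ (f≢id r)))
            }

      -- Whichever of `l` and `r` stands at `Q` is left horizontally towards `b` at `P`. So the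
      -- column order of `P` and `Q` decides: for `P < Q` that vertex is `r`, and for `Q < P` it is
      -- `l`, with the traversal reversed. In the first case `l` stands at `T`, and `f³b≢b` keeps
      -- `f l` away from `r`.
      markedNeighbours : g b ≡ r → f b ≡ l → f (f (f b)) ≢ b → Result f g ⊎ Result g f
      markedNeighbours gb≡r fb≡l f³b≢b =
        let (P , Q , T , t , mid) = nested q o (q∉ ∘ low) in orient t mid (ℕ.<-cmp P Q)
        where
        fr≡b : f r ≡ b
        fr≡b = trans (cong f (sym gb≡r)) (f∘g b)

        gl≡b : g l ≡ b
        gl≡b = trans (cong g (sym fb≡l)) (g∘f b)

        orient : ∀ {P Q T} → Triple o P Q T → Mid _≺_ Q P q → Tri (P < Q) (P ≡ Q) (Q < P) →
                 Result f g ⊎ Result g f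
        orient t _ (tri≈ _ P≡Q _) = contradiction P≡Q (Triple.P≢Q t)
        orient {P} {Q} {T} t mid (tri< P<Q _ _) = inj₁ (build (prescribe base
            ((b , P) ∷ (r , Q) ∷ (l , T) ∷ [])
            (((b≢r , P≢Q) ∷ (b≢l , P≢T) ∷ []) ∷ ((≢-sym l≢r , Q≢T) ∷ []) ∷ [] ∷ [])
            (low P∈ ∷ low Q∈ ∷ low T∈ ∷ [])))
          where
          open Triple t
          build : Σ[ ι ∈ Placement (4 + j) (Window o hi) ] All (λ a → col ι (proj₁ a) ≡ proj₂ a)
                    ((b , P) ∷ (r , Q) ∷ (l , T) ∷ []) → Result f g
          build (ι , b≡ ∷ r≡ ∷ l≡ ∷ []) = ι , record
            { b-ok = subst₂ (λ Q P → Mid _≺_ Q P q) (sym (trans (cong (col ι) gb≡r) r≡)) (sym b≡) mid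
            ; l-ok = subst (_< col ι (f l)) (sym l≡)
                       (below-rest t (proj₁ (window ι (f l)))
                         (differ ι b≡ (λ fl≡b → l≢r (trans (sym (g∘f l)) (trans (cong g fl≡b) gb≡r))))
                         (differ ι r≡ (λ fl≡r → f³b≢b (trans (cong (f ∘ f) fb≡l) (trans (cong f fl≡r) fr≡b))))
                         (differ ι l≡ (f≢id l)))
            ; r-ok = subst₂ _<_ (sym (trans (cong (col ι) fr≡b) b≡)) (sym r≡) P<Q
            }
        orient {P} {Q} {T} t mid (tri> _ _ Q<P) = inj₂ (build (prescribe base
            ((b , P) ∷ (l , Q) ∷ (r , last) ∷ [])
            (((b≢l , P≢Q) ∷ (b≢r , low≢last P∈) ∷ []) ∷ ((l≢r , low≢last Q∈) ∷ []) ∷ [] ∷ [])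
            (low P∈ ∷ low Q∈ ∷ last∈ ∷ [])))
          where
          open Triple t
          build : Σ[ ι ∈ Placement (4 + j) (Window o hi) ] All (λ a → col ι (proj₁ a) ≡ proj₂ a)
                    ((b , P) ∷ (l , Q) ∷ (r , last) ∷ []) → Result g f
          build (ι , b≡ ∷ l≡ ∷ r≡ ∷ []) = ι , record
            { b-ok = subst₂ (λ Q P → Mid _≺_ Q P q) (sym (trans (cong (col ι) fb≡l) l≡)) (sym b≡) mid
            ; l-ok = subst₂ _<_ (sym l≡) (sym (trans (cong (col ι) gl≡b) b≡)) Q<P
            ; r-ok = subst (col ι (g r) <_) (sym r≡) (<last (window ι (g r)) (differ ι r≡ (g≢id r)))
            }

    private
      nxt≢id : ∀ (v : Fin (4 + j)) → nxt v ≢ v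
      nxt≢id v eq = prv≢id v (trans (cong prv (sym eq)) (prv-nxt v))

      module F = Traversal nxt prv prv-nxt nxt-prv nxt≢id prv≢id
      module B = Traversal prv nxt nxt-prv prv-nxt prv≢id nxt≢id

      nxt³≢id : nxt (nxt (nxt b)) ≢ b
      nxt³≢id eq = prv³≢id b (trans (cong (prv ∘ prv ∘ prv) (sym eq))
        (trans (cong (prv ∘ prv) (prv-nxt (nxt (nxt b)))) (trans (cong prv (prv-nxt (nxt b))) (prv-nxt b))))

      nxt≢prv : nxt b ≢ prv b
      nxt≢prv eq = prv²≢id b (trans (cong prv (sym eq)) (prv-nxt b))

      search : Result nxt prv ⊎ Result prv nxt
      search with prv b ≟ᶠ l | prv b ≟ᶠ r | nxt b ≟ᶠ l | nxt b ≟ᶠ r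
      ... | no p≢l | no p≢r | _      | _      = inj₁ (F.unmarkedNeighbour p≢l p≢r)
      ... | _      | _      | no n≢l | no n≢r = inj₂ (B.unmarkedNeighbour n≢l n≢r)
      -- From here on both neighbours of `b` are among `l` and `r`; being different vertices, one is
      -- `l` and the other `r`.
      ... | _      | yes p≡r | yes n≡l | _     = F.markedNeighbours p≡r n≡l nxt³≢id
      ... | yes p≡l | _     | _      | yes n≡r = ⊎-swap (B.markedNeighbours n≡r p≡l (prv³≢id b))
      ... | yes p≡l | no _  | yes n≡l | no _  = contradiction (trans n≡l (sym p≡l)) nxt≢prv
      ... | no _  | yes p≡r | no _  | yes n≡r = contradiction (trans n≡r (sym p≡r)) nxt≢prv

    longCycle : CycleLayout b l r (Window o hi) q
    longCycle with search
    ... | inj₁ (ι , good) = DirectedCycle.forward ι good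
    ... | inj₂ (ι , good) = DirectedCycle.backward ι good

  -- Triangles.

  triangleEdges : (b l r : Fin 3) → b ≢ l → b ≢ r → l ≢ r → ∀ {κ : Fin 3 → ℕ} {bl br lr} →
                  Drawn κ (b , l) bl → Drawn κ (b , r) br → Drawn κ (l , r) lr →
                  Σ[ ds ∈ List (ℕ × ℕ) ] Pointwise (Drawn κ) (cycleEdges 2) ds × bl ∷ br ∷ lr ∷ [] ↭ ds
  -- The edges of a triangle are all pairs of its vertices, so each of the six assignments of the
  -- roles `b`, `l`, `r` merely permutes and reverses the entries of the edge list.
  triangleEdges zero (suc zero) (suc (suc zero)) _ _ _ dbl dbr dlr =
    _ , ⊎-swap dbr ∷ dbl ∷ dlr ∷ [] , swap _ _ ↭-refl
  triangleEdges zero (suc (suc zero)) (suc zero) _ _ _ dbl dbr dlr =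
    _ , ⊎-swap dbl ∷ dbr ∷ ⊎-swap dlr ∷ [] , ↭-refl
  triangleEdges (suc zero) zero (suc (suc zero)) _ _ _ dbl dbr dlr =
    _ , ⊎-swap dlr ∷ ⊎-swap dbl ∷ dbr ∷ [] , ↭-trans (prep _ (swap _ _ ↭-refl)) (swap _ _ ↭-refl)
  triangleEdges (suc zero) (suc (suc zero)) zero _ _ _ dbl dbr dlr =
    _ , dlr ∷ ⊎-swap dbr ∷ dbl ∷ [] ,
    ↭-trans (swap _ _ ↭-refl) (↭-trans (prep _ (swap _ _ ↭-refl)) (swap _ _ ↭-refl))
  triangleEdges (suc (suc zero)) zero (suc zero) _ _ _ dbl dbr dlr =
    _ , dbl ∷ dlr ∷ ⊎-swap dbr ∷ [] , prep _ (swap _ _ ↭-refl)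
  triangleEdges (suc (suc zero)) (suc zero) zero _ _ _ dbl dbr dlr =
    _ , dbr ∷ ⊎-swap dlr ∷ ⊎-swap dbl ∷ [] , ↭-trans (swap _ _ ↭-refl) (prep _ (swap _ _ ↭-refl))
  triangleEdges zero             zero             _                b≢l _ _ = contradiction refl b≢l
  triangleEdges (suc zero)       (suc zero)       _                b≢l _ _ = contradiction refl b≢l
  triangleEdges (suc (suc zero)) (suc (suc zero)) _                b≢l _ _ = contradiction refl b≢l
  triangleEdges zero             _                zero             _ b≢r _ = contradiction refl b≢r
  triangleEdges (suc zero)       _                (suc zero)       _ b≢r _ = contradiction refl b≢r
  triangleEdges (suc (suc zero)) _                (suc (suc zero)) _ b≢r _ = contradiction refl b≢r
  triangleEdges _                zero             zero             _ _ l≢r = contradiction refl l≢r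
  triangleEdges _                (suc zero)       (suc zero)       _ _ l≢r = contradiction refl l≢r
  triangleEdges _                (suc (suc zero)) (suc (suc zero)) _ _ l≢r = contradiction refl l≢r

  module Triangle (o q : ℕ) (q∉ : ¬ Window o (3 + o) q) where

    private
      L B R : ℕ
      L = o
      B = 1 + o
      R = 2 + o

      Oriented : ℕ → ℕ → ℕ × ℕ → Set
      Oriented c c′ d = d ≡ (c , c′) ⊎ d ≡ (c′ , c)

      record Orientation : Set where
        field
          {bl br lr} : ℕ × ℕ
          bl-ends    : Oriented B L bl
          br-ends    : Oriented B R br
          lr-ends    : Oriented L R lr
          pairwise   : AllPairs Compat (bl ∷ br ∷ lr ∷ [])
          bFree      : FreeTowards q B (bl ∷ br ∷ lr ∷ [])
          lFree      : FreeLeft L (bl ∷ br ∷ lr ∷ [])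
          rFree      : FreeRight R (bl ∷ br ∷ lr ∷ [])

      L<B : L < B
      L<B = ℕ.≤-refl
      B<R : B < R
      B<R = ℕ.≤-refl
      L<R : L < R
      L<R = ℕ.m≤n+m (1 + o) 1

      -- Column `B` lies between the other two, so both its edges can leave horizontally, which
      -- keeps it vertically free on whichever side `q` is. As `L` is the vertical median, both
      -- edges at `L` can leave vertically. In `right-median` the parts of `L` and `R` are
      -- exchanged.
      left-median : Mid _≺_ B L R → Orientation
      left-median mid = record
        { bl-ends = inj₁ refl ; br-ends = inj₁ refl ; lr-ends = inj₂ refl
        ; pairwise = (((λ _ → inj₁ (L<B , B<R)) , λ ()) ∷ ((λ ()) , (λ _ → mid)) ∷ []) ∷
                    (((λ ()) , λ ()) ∷ []) ∷ [] ∷ []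
        ; bFree   = (λ ()) ∷ (λ ()) ∷ (λ ()) ∷ []
        ; lFree   = (λ ()) ∷ (λ ()) ∷ (λ ()) ∷ []
        ; rFree   = (λ ()) ∷ (λ ()) ∷ (λ _ → L<R) ∷ []
        }

      right-median : Mid _≺_ B R L → Orientation
      right-median mid = record
        { bl-ends = inj₁ refl ; br-ends = inj₁ refl ; lr-ends = inj₁ refl
        ; pairwise = (((λ _ → inj₁ (L<B , B<R)) , λ ()) ∷ ((λ ()) , (λ ())) ∷ []) ∷
                    (((λ ()) , λ _ → mid) ∷ []) ∷ [] ∷ []
        ; bFree   = (λ ()) ∷ (λ ()) ∷ (λ ()) ∷ []
        ; lFree   = (λ ()) ∷ (λ ()) ∷ (λ _ → L<R) ∷ []
        ; rFree   = (λ ()) ∷ (λ ()) ∷ (λ ()) ∷ []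
        }

      -- A cyclic traversal, named by the order in which vertices are left horizontally; `B`
      -- therefore reaches `R` vertically.
      b→l→r : Mid _≺_ R B q → Orientation
      b→l→r mid = record
        { bl-ends = inj₁ refl ; br-ends = inj₂ refl ; lr-ends = inj₁ refl
        ; pairwise = (((λ ()) , λ ()) ∷ ((λ ()) , (λ ())) ∷ []) ∷
                    (((λ ()) , λ ()) ∷ []) ∷ [] ∷ []
        ; bFree   = (λ ()) ∷ (λ _ → mid) ∷ (λ ()) ∷ []
        ; lFree   = (λ ()) ∷ (λ ()) ∷ (λ _ → L<R) ∷ []
        ; rFree   = (λ ()) ∷ (λ _ → B<R) ∷ (λ ()) ∷ []
        }

      b→r→l : Mid _≺_ L B q → Orientation
      b→r→l mid = record
        { bl-ends = inj₂ refl ; br-ends = inj₁ refl ; lr-ends = inj₂ refl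
        ; pairwise = (((λ ()) , λ ()) ∷ ((λ ()) , (λ ())) ∷ []) ∷
                    (((λ ()) , λ ()) ∷ []) ∷ [] ∷ []
        ; bFree   = (λ _ → mid) ∷ (λ ()) ∷ (λ ()) ∷ []
        ; lFree   = (λ _ → L<B) ∷ (λ ()) ∷ (λ ()) ∷ []
        ; rFree   = (λ ()) ∷ (λ ()) ∷ (λ _ → L<R) ∷ []
        }

      orientation : Orientation
      orientation with ≺-connex {L} {B} (λ ()) | ≺-connex {B} {R} (λ ()) | ≺-connex {L} {R} (λ ())
                     | ≺-connex {q} {B} (λ { refl → q∉ (ℕ.n≤1+n o , ℕ.n≤1+n R) })
      -- When `B` is the vertical median, it reaches vertically the neighbour on the side away from
      -- `q`.
      ... | inj₁ L≺B | inj₁ B≺R | _        | inj₁ q≺B = b→l→r (inj₂ (q≺B , B≺R))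
      ... | inj₁ L≺B | inj₁ B≺R | _        | inj₂ B≺q = b→r→l (inj₁ (L≺B , B≺q))
      ... | inj₂ B≺L | inj₂ R≺B | _        | inj₁ q≺B = b→r→l (inj₂ (q≺B , B≺L))
      ... | inj₂ B≺L | inj₂ R≺B | _        | inj₂ B≺q = b→l→r (inj₁ (R≺B , B≺q))
      -- When `B` is vertically extreme, the median is `L` or `R`.
      ... | inj₁ L≺B | inj₂ R≺B | inj₁ L≺R | _        = right-median (inj₂ (L≺R , R≺B))
      ... | inj₁ L≺B | inj₂ R≺B | inj₂ R≺L | _        = left-median (inj₂ (R≺L , L≺B))
      ... | inj₂ B≺L | inj₁ B≺R | inj₁ L≺R | _        = left-median (inj₁ (B≺L , L≺R))
      ... | inj₂ B≺L | inj₁ B≺R | inj₂ R≺L | _        = right-median (inj₁ (B≺R , R≺L))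

    triangle : ∀ {b l r : Fin 3} → b ≢ l → b ≢ r → l ≢ r → CycleLayout b l r (Window o (3 + o)) q
    triangle {b} {l} {r} b≢l b≢r l≢r =
      build (prescribe (shift 3 o) ((b , B) ∷ (l , L) ∷ (r , R) ∷ [])
        (((b≢l , λ ()) ∷ (b≢r , λ ()) ∷ []) ∷ ((l≢r , λ ()) ∷ []) ∷ [] ∷ [])
        ((ℕ.n≤1+n o , ℕ.n≤1+n R) ∷ (ℕ.≤-refl , ℕ.m≤n+m (1 + o) 2) ∷ (ℕ.m≤n+m o 2 , ℕ.≤-refl) ∷ []))
      where
      open Orientation orientation
      build : Σ[ ι ∈ Placement 3 (Window o (3 + o)) ] All (λ a → col ι (proj₁ a) ≡ proj₂ a)
                ((b , B) ∷ (l , L) ∷ (r , R) ∷ []) → CycleLayout b l r (Window o (3 + o)) q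
      build (ι , b≡ ∷ l≡ ∷ r≡ ∷ []) =
        let ds , ends , perm = triangleEdges b l r b≢l b≢r l≢r {col ι}
              (subst₂ (λ c c′ → Oriented c c′ bl) (sym b≡) (sym l≡) bl-ends)
              (subst₂ (λ c c′ → Oriented c c′ br) (sym b≡) (sym r≡) br-ends)
              (subst₂ (λ c c′ → Oriented c c′ lr) (sym l≡) (sym r≡) lr-ends)
        in record
        { layout = record
          { placement = ι
          ; directed  = ds
          ; drawn     = ends
          ; compat    = Permutationₛ.AllPairs-resp-↭ (setoid _) compat-sym (resp₂ Compat) (↭⇒↭ₛ perm) pairwise
          }
        ; bFree = All-resp-↭ perm (subst (λ c → FreeTowards q c _) (sym b≡) bFree)
        ; lFree = All-resp-↭ perm (subst (λ c → FreeLeft c _) (sym l≡) lFree)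
        ; rFree = All-resp-↭ perm (subst (λ c → FreeRight c _) (sym r≡) rFree)
        }

  cycle : ∀ j {b l r : Fin (3 + j)} → b ≢ l → b ≢ r → l ≢ r →
          ∀ o q → ¬ Window o (3 + j + o) q → CycleLayout b l r (Window o (3 + j + o)) q
  cycle zero    b≢l b≢r l≢r o q q∉ = Triangle.triangle o q q∉ b≢l b≢r l≢r
  cycle (suc j) b≢l b≢r l≢r o q q∉ = LongCycle.longCycle j o q q∉ b≢l b≢r l≢r

  -- Assembling the layout of a tree.

  drawn-map : ∀ {m n} {κ : Fin n → ℕ} {κ′ : Fin m → ℕ} (f : Fin m → Fin n) → (∀ v → κ (f v) ≡ κ′ v) →
              ∀ {es ds} → Pointwise (Drawn κ′) es ds → Pointwise (Drawn κ) (mapPair f es) ds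
  drawn-map f eq []         = []
  drawn-map {κ = κ} {κ′} f eq {(u , v) ∷ es} {d ∷ ds} (dr ∷ drs) =
    subst₂ (λ c c′ → d ≡ (c , c′) ⊎ d ≡ (c′ , c)) (sym (eq u)) (sym (eq v)) dr ∷ drawn-map f eq drs

  Both : (ℕ → Set) → ℕ × ℕ → Set
  Both W (h , v) = W h × W v

  inside : ∀ {n es W} (L : Layout {n} es W) → All (Both W) (directed L)
  inside {W = W} L = go (drawn L)
    where
    in-window : ∀ v → W (col (placement L) v)
    in-window = window (placement L)

    go : ∀ {es ds} → Pointwise (Drawn (col (placement L))) es ds → All (Both W) ds
    go []                                   = []
    go {(u , v) ∷ _} (inj₁ refl ∷ drs) = (in-window u , in-window v) ∷ go drs
    go {(u , v) ∷ _} (inj₂ refl ∷ drs) = (in-window v , in-window u) ∷ go drs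

  apart : ∀ {W W′ d d′} → Disjoint W W′ → Both W d → Both W′ d′ → Compat d d′
  apart disj (h∈ , v∈) (h′∈ , v′∈) = (λ eq → contradiction eq (disj h∈ h′∈)) , (λ eq → contradiction eq (disj v∈ v′∈))

  apart-all : ∀ {W W′ ds ds′} → Disjoint W W′ → All (Both W) ds → All (Both W′) ds′ →
              All (λ d → All (Compat d) ds′) ds
  apart-all disj ∈W ∈W′ = All.map (λ d∈ → All.map (apart disj d∈) ∈W′) ∈W

  Turns : ℕ → ℕ → List (ℕ × ℕ) → Set
  Turns a b = All (λ d → proj₁ d ≡ a → Mid _<_ (proj₂ d) a b)

  turnsLeft : ∀ {a b ds} → b < a → FreeLeft a ds → Turns a b ds
  turnsLeft b<a = All.map λ free eq → inj₂ (b<a , free eq)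

  turnsRight : ∀ {a b ds} → a < b → FreeRight a ds → Turns a b ds
  turnsRight a<b = All.map λ free eq → inj₁ (free eq , a<b)

  -- The link leaves `a` horizontally and `b` vertically, so edges of the parent cycle can conflict
  -- with it only at `a`.
  parent-link : ∀ {W W′ a b ds} → Disjoint W W′ → W′ b → All (Both W) ds → Turns a b ds →
                All (λ d → Compat d (a , b)) ds
  parent-link disj b∈ ds∈ turns =
    All.map (λ { (d∈ , turn) → (λ { refl → turn refl }) , (λ eq → contradiction eq (disj (proj₂ d∈) b∈)) }) (All.zip (ds∈ , turns))

  -- Edges of the child can conflict with the link only at `b`, where the child was laid out with
  -- `a` as its `q`.
  link-child : ∀ {W W′ a b ds} → Disjoint W W′ → W a → All (Both W′) ds → FreeTowards a b ds →
               All (Compat (a , b)) ds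
  link-child disj a∈ ds∈ free = All.map
    (λ { (d∈ , f) → (λ eq → contradiction eq (disj a∈ (proj₁ d∈))) ,
                    (λ { refl → mid-sym {_<_ = _≺_} (f refl) }) })
    (All.zip (ds∈ , free))

  TreeLayout : ∀ {k} → CycTree k → Fin k → ℕ → ℕ → Set
  TreeLayout c b o q = Σ[ L ∈ Layout (edges c) (Window o (size c + o)) ]
                         FreeTowards q (col (placement L) (rootV c b)) (directed L)

  -- Every edge outside the root cycle, links included, has its vertical end in a column of a child.
  -- Hence `b` stays vertically free towards `q`.
  assemble : ∀ {j b l r q o W W′} (ch : Children (3 + j)) (C : CycleLayout b l r W q)
             (κ : Placement (csize ch) W′) (disj : Disjoint W W′) →
             (∀ {c} → (W ∪ W′) c → Window o (3 + j + csize ch + o) c) →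
             (ds : List (ℕ × ℕ)) →
             Pointwise (Drawn (col (union (placement (CycleLayout.layout C)) κ disj))) (cedges ch) ds →
             AllPairs Compat ds → All (W′ ∘ proj₂) ds →
             All (λ d → All (Compat d) ds) (directed (CycleLayout.layout C)) →
             TreeLayout (node j ch) b o q
  assemble {j} {b} ch C κ disj W⊆ ds dr comp vs∈ cross = record
    { placement = widen W⊆ (union ι κ disj)
    ; directed  = directed layout ++ ds
    ; drawn     = Pointwise.++⁺ (drawn-map (_↑ˡ csize ch) (union-ˡ ι κ disj) (drawn layout)) dr
    ; compat    = AllPairs.++⁺ (compat layout) comp cross
    } , subst (λ c → FreeTowards _ c _) (sym (union-ˡ ι κ disj b))
          (All.++⁺ bFree (All.map (λ v∈ eq → contradiction (sym eq) (disj (window ι b) v∈)) vs∈))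
    where
    open CycleLayout C
    ι = placement layout

  empty : Placement 0 (λ _ → ⊥)
  empty = record { col = λ () ; injective = λ {} ; window = λ () }

  none-layout : ∀ {j} (b : Fin (3 + j)) o q → ¬ Window o (3 + j + 0 + o) q → TreeLayout (node j none) b o q
  none-layout {j} b o q q∉ = assemble none
      (cycle j (≢-sym l≢b) (≢-sym r≢b) (≢-sym r≢l) o q (q∉ ∘ grow)) empty (λ _ ())
      (λ { (inj₁ w) → grow w }) [] [] [] [] (All.universal (λ _ → []) _)
    where
    grow : ∀ {c} → Window o (3 + j + o) c → Window o (3 + j + 0 + o) c
    grow {c} = subst (λ n → Window o (n + o) c) (sym (ℕ.+-identityʳ (3 + j)))
    -- Without children, arbitrary further vertices of the cycle take the roles of `l` and `r`.
    l = proj₁ (fresh b b)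
    l≢b = proj₁ (proj₂ (fresh b b))
    r = proj₁ (fresh b l)
    r≢b = proj₁ (proj₂ (fresh b l))
    r≢l = proj₂ (proj₂ (fresh b l))

  ChildLayouts : ∀ {k} → CycTree k → Fin k → Set
  ChildLayouts c b = ∀ o q → ¬ Window o (size c + o) q → TreeLayout c b o q

  one-layout : ∀ {j k} (a : Fin (3 + j)) (b′ : Fin k) (c : CycTree k) (b : Fin (3 + j)) → b ≢ a →
               ChildLayouts c b′ → ChildLayouts (node j (one a b′ c)) b
  one-layout {j} a b′ c b b≢a child o q q∉ =
      assemble (one a b′ c) C (placement L) disj grow (link ∷ directed L)
        (inj₁ (sym (cong₂ _,_ (union-ˡ ι (placement L) disj a) (union-ʳ ι (placement L) disj (rootV c b′)))) ∷
         drawn-map (3 + j ↑ʳ_) (union-ʳ ι (placement L) disj) (drawn L))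
        (link-child disj (window ι a) (inside L) Lfree ∷ compat L)
        (b∈ ∷ All.map proj₂ (inside L))
        (All.map (λ { (t , ts) → t ∷ ts })
          (All.zip (parent-link disj b∈ (inside layout) (turnsLeft b<a lFree) ,
                    apart-all disj (inside layout) (inside L))))
    where
    s mid : ℕ
    s   = size c
    mid = s + o

    W W′ : ℕ → Set
    W  = Window mid (3 + j + mid)
    W′ = Window o mid

    disj : Disjoint W W′
    disj = disjoint-sym (window-disjoint ℕ.≤-refl)

    grow : ∀ {x} → (W ∪ W′) x → Window o (3 + j + s + o) x
    grow {x} w = subst (λ n → Window o n x) (sym (ℕ.+-assoc (3 + j) s o)) (grow′ w)
      where
      grow′ : ∀ {x} → (W ∪ W′) x → Window o (3 + j + mid) x
      grow′ (inj₁ (mid≤x , x<)) = ℕ.≤-trans (ℕ.m≤n+m o s) mid≤x , x<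
      grow′ (inj₂ (o≤x , x<))   = o≤x , ℕ.<-≤-trans x< (ℕ.m≤n+m mid (3 + j))

    r≢ : Σ[ r ∈ Fin (3 + j) ] r ≢ b × r ≢ a
    r≢ = fresh b a

    C : CycleLayout b a (proj₁ r≢) W q
    C = cycle j b≢a (≢-sym (proj₁ (proj₂ r≢))) (≢-sym (proj₂ (proj₂ r≢))) mid q (q∉ ∘ grow ∘ inj₁)
    open CycleLayout C
    ι : Placement (3 + j) W
    ι = placement layout

    -- The root cycle is laid out first, since the child needs the column of `a` as its own `q`.
    sub : TreeLayout c b′ o (col ι a)
    sub = child o (col ι a) (λ w → disj (window ι a) w refl)
    L : Layout (edges c) W′
    L = proj₁ sub
    Lfree : FreeTowards (col ι a) (col (placement L) (rootV c b′)) (directed L)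
    Lfree = proj₂ sub

    link : ℕ × ℕ
    link = col ι a , col (placement L) (rootV c b′)
    b∈ : W′ (proj₂ link)
    b∈ = window (placement L) (rootV c b′)
    b<a : proj₂ link < proj₁ link
    b<a = ℕ.<-≤-trans (proj₂ b∈) (proj₁ (window ι a))

  -- Vertices are numbered with the cycle first, whereas columns run through the first child, the
  -- cycle and the second child. Compatibility is checked block by block; beyond what holds within a
  -- block, only the ends of the two links need an argument other than disjointness of windows.
  two-layout : ∀ {j k₁ k₂} (a₁ : Fin (3 + j)) (b₁ : Fin k₁) (c₁ : CycTree k₁)
               (a₂ : Fin (3 + j)) (b₂ : Fin k₂) (c₂ : CycTree k₂) (b : Fin (3 + j)) →
               b ≢ a₁ → b ≢ a₂ → a₁ ≢ a₂ →
               ChildLayouts c₁ b₁ → ChildLayouts c₂ b₂ → ChildLayouts (node j (two a₁ b₁ c₁ a₂ b₂ c₂)) b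
  two-layout {j} a₁ b₁ c₁ a₂ b₂ c₂ b b≢a₁ b≢a₂ a₁≢a₂ child₁ child₂ o q q∉ =
      assemble (two a₁ b₁ c₁ a₂ b₂ c₂) C κ disj grow (link₁ ∷ link₂ ∷ directed L₁ ++ directed L₂)
        (inj₁ (sym (cong₂ _,_ (union-ˡ ι κ disj a₁) (col-₁ (rootV c₁ b₁)))) ∷
         inj₁ (sym (cong₂ _,_ (union-ˡ ι κ disj a₂) (col-₂ (rootV c₂ b₂)))) ∷
         Pointwise.++⁺ (drawn-map _ col-₁ (drawn L₁)) (drawn-map _ col-₂ (drawn L₂)))
        ((((λ eq → contradiction (injective ι eq) a₁≢a₂) , (λ eq → contradiction eq (disj₁₂ r₁∈ r₂∈))) ∷
         All.++⁺ (link-child disj₁ (window ι a₁) (inside L₁) free₁)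
                 (All.map (λ d∈ → (λ eq → contradiction eq (disj₂ (window ι a₁) (proj₁ d∈))) ,
                                  (λ eq → contradiction eq (disj₁₂ r₁∈ (proj₂ d∈)))) (inside L₂))) ∷
         All.++⁺ (All.map (λ d∈ → (λ eq → contradiction eq (disj₁ (window ι a₂) (proj₁ d∈))) ,
                                  (λ eq → contradiction (sym eq) (disj₁₂ (proj₂ d∈) r₂∈))) (inside L₁))
                 (link-child disj₂ (window ι a₂) (inside L₂) free₂) ∷
         AllPairs.++⁺ (compat L₁) (compat L₂) (apart-all disj₁₂ (inside L₁) (inside L₂)))
        (inj₁ r₁∈ ∷ inj₂ r₂∈ ∷ All.++⁺ (All.map (inj₁ ∘ proj₂) (inside L₁)) (All.map (inj₂ ∘ proj₂) (inside L₂)))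
        (All.map (λ { ((t₁ , ts₁) , (t₂ , ts₂)) → t₁ ∷ t₂ ∷ All.++⁺ ts₁ ts₂ })
          (All.zip
            (All.zip (parent-link disj₁ r₁∈ (inside layout) (turnsLeft r₁<a₁ lFree) ,
                      apart-all disj₁ (inside layout) (inside L₁)) ,
             All.zip (parent-link disj₂ r₂∈ (inside layout) (turnsRight a₂<r₂ rFree) ,
                      apart-all disj₂ (inside layout) (inside L₂)))))
    where
    s₁ s₂ mid₁ mid₂ : ℕ
    s₁   = size c₁
    s₂   = size c₂
    mid₁ = s₁ + o
    mid₂ = 3 + j + mid₁

    W W₁ W₂ : ℕ → Set
    W₁ = Window o mid₁
    W  = Window mid₁ mid₂
    W₂ = Window mid₂ (s₂ + mid₂)

    disj₁ : Disjoint W W₁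
    disj₁ = disjoint-sym (window-disjoint ℕ.≤-refl)
    disj₂ : Disjoint W W₂
    disj₂ = window-disjoint ℕ.≤-refl
    disj₁₂ : Disjoint W₁ W₂
    disj₁₂ = window-disjoint (ℕ.m≤n+m mid₁ (3 + j))
    disj : Disjoint W (W₁ ∪ W₂)
    disj w (inj₁ w₁) = disj₁ w w₁
    disj w (inj₂ w₂) = disj₂ w w₂

    total : s₂ + mid₂ ≡ 3 + j + (s₁ + s₂) + o
    total = solve 4 (λ s t k o → t :+ (k :+ (s :+ o)) := k :+ (s :+ t) :+ o) refl s₁ s₂ (3 + j) o

    grow : ∀ {x} → (W ∪ (W₁ ∪ W₂)) x → Window o (3 + j + (s₁ + s₂) + o) x
    grow {x} w = subst (λ n → Window o n x) total (grow′ w)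
      where
      grow′ : ∀ {x} → (W ∪ (W₁ ∪ W₂)) x → Window o (s₂ + mid₂) x
      grow′ (inj₁ (mid₁≤x , x<))        = ℕ.≤-trans (ℕ.m≤n+m o s₁) mid₁≤x , ℕ.<-≤-trans x< (ℕ.m≤n+m mid₂ s₂)
      grow′ (inj₂ (inj₁ (o≤x , x<)))    =
        o≤x , ℕ.<-≤-trans x< (ℕ.≤-trans (ℕ.m≤n+m mid₁ (3 + j)) (ℕ.m≤n+m mid₂ s₂))
      grow′ (inj₂ (inj₂ (mid₂≤x , x<))) =
        ℕ.≤-trans (ℕ.≤-trans (ℕ.m≤n+m o s₁) (ℕ.m≤n+m mid₁ (3 + j))) mid₂≤x , x<

    C : CycleLayout b a₁ a₂ W q
    C = cycle j b≢a₁ b≢a₂ a₁≢a₂ mid₁ q (q∉ ∘ grow ∘ inj₁)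
    open CycleLayout C
    ι : Placement (3 + j) W
    ι = placement layout

    sub₁ : TreeLayout c₁ b₁ o (col ι a₁)
    sub₁ = child₁ o (col ι a₁) (λ w → disj₁ (window ι a₁) w refl)
    sub₂ : TreeLayout c₂ b₂ mid₂ (col ι a₂)
    sub₂ = child₂ mid₂ (col ι a₂) (λ w → disj₂ (window ι a₂) w refl)
    L₁ : Layout (edges c₁) W₁
    L₁ = proj₁ sub₁
    L₂ : Layout (edges c₂) W₂
    L₂ = proj₁ sub₂
    free₁ : FreeTowards (col ι a₁) (col (placement L₁) (rootV c₁ b₁)) (directed L₁)
    free₁ = proj₂ sub₁
    free₂ : FreeTowards (col ι a₂) (col (placement L₂) (rootV c₂ b₂)) (directed L₂)
    free₂ = proj₂ sub₂

    κ : Placement (s₁ + s₂) (W₁ ∪ W₂)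
    κ = union (placement L₁) (placement L₂) disj₁₂
    col-₁ : ∀ v → col (union ι κ disj) (3 + j ↑ʳ (v ↑ˡ s₂)) ≡ col (placement L₁) v
    col-₁ v = trans (union-ʳ ι κ disj (v ↑ˡ s₂)) (union-ˡ (placement L₁) (placement L₂) disj₁₂ v)
    col-₂ : ∀ v → col (union ι κ disj) (3 + j ↑ʳ (s₁ ↑ʳ v)) ≡ col (placement L₂) v
    col-₂ v = trans (union-ʳ ι κ disj (s₁ ↑ʳ v)) (union-ʳ (placement L₁) (placement L₂) disj₁₂ v)

    link₁ link₂ : ℕ × ℕ
    link₁ = col ι a₁ , col (placement L₁) (rootV c₁ b₁)
    link₂ = col ι a₂ , col (placement L₂) (rootV c₂ b₂)
    r₁∈ : W₁ (proj₂ link₁)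
    r₁∈ = window (placement L₁) (rootV c₁ b₁)
    r₂∈ : W₂ (proj₂ link₂)
    r₂∈ = window (placement L₂) (rootV c₂ b₂)
    r₁<a₁ : proj₂ link₁ < proj₁ link₁
    r₁<a₁ = ℕ.<-≤-trans (proj₂ r₁∈) (proj₁ (window ι a₁))
    a₂<r₂ : proj₁ link₂ < proj₂ link₂
    a₂<r₂ = ℕ.<-≤-trans (proj₂ (window ι a₂)) (proj₁ r₂∈)

  treeLayout : ∀ {k} (c : CycTree k) → DistinctPorts c → (b : Fin k) → FreeRoot c b → ChildLayouts c b
  treeLayout (node j none) _ b _ = none-layout b
  treeLayout (node j (one a b′ c)) (ports , free) b b≢a =
    one-layout a b′ c b b≢a (treeLayout c ports b′ free)
  treeLayout (node j (two a₁ b₁ c₁ a₂ b₂ c₂)) (a₁≢a₂ , (ports₁ , free₁) , (ports₂ , free₂)) b (b≢a₁ , b≢a₂) =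
    two-layout a₁ b₁ c₁ a₂ b₂ c₂ b b≢a₁ b≢a₂ a₁≢a₂ (treeLayout c₁ ports₁ b₁ free₁) (treeLayout c₂ ports₂ b₂ free₂)

-- Degrees and attachment vertices.

sumFin-lookup : ∀ {A : Set} (g : A → ℕ) xs → sumFin (λ i → g (lookup xs i)) ≡ sum (map g xs)
sumFin-lookup g []       = refl
sumFin-lookup g (x ∷ xs) = cong (λ s → g x + s) (sumFin-lookup g xs)

sum-tabulate₁ : ∀ {n} (f : Fin n → ℕ) i → f i ≤ sum (tabulate f)
sum-tabulate₁ f zero    = ℕ.m≤m+n (f zero) _
sum-tabulate₁ f (suc i) = ℕ.≤-trans (sum-tabulate₁ (f ∘ suc) i) (ℕ.m≤n+m _ (f zero))

sum-tabulate₂ : ∀ {n} (f : Fin n → ℕ) {i i′} → i ≢ i′ → f i + f i′ ≤ sum (tabulate f)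
sum-tabulate₂ f {zero}  {zero}   i≢i′ = contradiction refl i≢i′
sum-tabulate₂ f {zero}  {suc i′} i≢i′ = ℕ.+-monoʳ-≤ (f zero) (sum-tabulate₁ (f ∘ suc) i′)
sum-tabulate₂ f {suc i} {zero}   i≢i′ =
  ℕ.≤-trans (ℕ.≤-reflexive (ℕ.+-comm (f (suc i)) (f zero))) (ℕ.+-monoʳ-≤ (f zero) (sum-tabulate₁ (f ∘ suc) i))
sum-tabulate₂ f {suc i} {suc i′} i≢i′ =
  ℕ.≤-trans (sum-tabulate₂ (f ∘ suc) (i≢i′ ∘ cong suc)) (ℕ.m≤n+m _ (f zero))

abstract

  incident : ∀ {n} → Fin n → Fin n × Fin n → ℕ
  incident v e = if does (v ≟ᶠ proj₁ e) ∨ does (v ≟ᶠ proj₂ e) then 1 else 0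

  degree : ∀ {n} → Fin n → List (Fin n × Fin n) → ℕ
  degree v es = sum (map (incident v) es)

  incident-end : ∀ {n} {v : Fin n} {e} → v ≡ proj₁ e ⊎ v ≡ proj₂ e → incident v e ≡ 1
  incident-end {v = v} {a , b} hit with v ≟ᶠ a | v ≟ᶠ b | hit
  ... | yes _  | _      | _         = refl
  ... | no _   | yes _  | _         = refl
  ... | no v≢a | no _   | inj₁ v≡a  = contradiction v≡a v≢a
  ... | no _   | no v≢b | inj₂ v≡b  = contradiction v≡b v≢b

  incident-map : ∀ {m n} (f : Fin m → Fin n) v e → incident v e ≤ incident (f v) (f (proj₁ e) , f (proj₂ e))
  incident-map f v (a , b) with v ≟ᶠ a | v ≟ᶠ b
  ... | yes v≡a | _       = ℕ.≤-reflexive (sym (incident-end {v = f v} (inj₁ (cong f v≡a))))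
  ... | no _    | yes v≡b = ℕ.≤-reflexive (sym (incident-end {v = f v} (inj₂ (cong f v≡b))))
  ... | no _    | no _    = z≤n

  deg-toGraph : ∀ {k} (c : CycTree k) v → deg (toGraph c) v ≡ degree v (edges c)
  deg-toGraph c v = sumFin-lookup (incident v) (edges c)

  degree-map : ∀ {m n} (f : Fin m → Fin n) v es → degree v es ≤ degree (f v) (mapPair f es)
  degree-map f v []       = z≤n
  degree-map f v (e ∷ es) = ℕ.+-mono-≤ (incident-map f v e) (degree-map f v es)

  degree-++ : ∀ {n} (v : Fin n) es es′ → degree v (es ++ es′) ≡ degree v es + degree v es′
  degree-++ v es es′ = trans (cong sum (map-++ (incident v) es es′)) (sum-++ (map (incident v) es) _)

  degree-here : ∀ {n} {v : Fin n} {e es} → v ≡ proj₁ e ⊎ v ≡ proj₂ e → suc (degree v es) ≤ degree v (e ∷ es)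
  degree-here {v = v} {e} {es} hit = ℕ.≤-reflexive (cong (_+ degree v es) (sym (incident-end {v = v} {e} hit)))

  degree-there : ∀ {n} {v : Fin n} {e es} → degree v es ≤ degree v (e ∷ es)
  degree-there {v = v} {e} = ℕ.m≤n+m _ (incident v e)

  degree-++ˡ : ∀ {n} {v : Fin n} es {es′} → degree v es ≤ degree v (es ++ es′)
  degree-++ˡ {v = v} es = ℕ.≤-trans (ℕ.m≤m+n _ _) (ℕ.≤-reflexive (sym (degree-++ v es _)))

  degree-++ʳ : ∀ {n} {v : Fin n} es {es′} → degree v es′ ≤ degree v (es ++ es′)
  degree-++ʳ {v = v} es = ℕ.≤-trans (ℕ.m≤n+m _ (degree v es)) (ℕ.≤-reflexive (sym (degree-++ v es _)))

  -- The edges indexed by `v` and by `nxt v` both contain `v`, and their indices differ because no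
  -- vertex is its own predecessor.
  cycle-degree : ∀ p (v : Fin (2 + p)) → 2 ≤ degree v (cycleEdges (suc p))
  cycle-degree p v = begin
    2                                                  ≡⟨ cong₂ _+_ (incident-end {v = v} (inj₂ refl))
                                                                    (incident-end {v = v} (inj₁ (sym (prv-nxt v)))) ⟨
    f v + f (nxt v)                                    ≤⟨ sum-tabulate₂ f v≢nxt ⟩
    sum (tabulate f)                                   ≡⟨ cong sum (map-tabulate (λ u → prv u , u) (incident v)) ⟨
    sum (map (incident v) (tabulate (λ u → prv u , u))) ≡⟨ cong (degree v) (cycleEdges-tabulate (suc p)) ⟨
    degree v (cycleEdges (suc p))                      ∎
    where
    open ℕ.≤-Reasoning
    f : Fin (2 + p) → ℕ
    f u = incident v (prv u , u)
    v≢nxt : v ≢ nxt v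
    v≢nxt eq = prv≢id v (trans (cong prv eq) (prv-nxt v))

root-degree : ∀ {j} (ch : Children (3 + j)) (a : Fin (3 + j)) →
              2 + degree (a ↑ˡ csize ch) (cedges ch) ≤ degree (a ↑ˡ csize ch) (edges (node j ch))
root-degree {j} ch a = begin
  2 + degree u (cedges ch)
    ≤⟨ ℕ.+-monoˡ-≤ _ (ℕ.≤-trans (cycle-degree (suc j) a) (degree-map (_↑ˡ csize ch) a (cycleEdges (2 + j)))) ⟩
  degree u (mapPair (_↑ˡ csize ch) (cycleEdges (2 + j))) + degree u (cedges ch)
    ≡⟨ degree-++ u (mapPair (_↑ˡ csize ch) (cycleEdges (2 + j))) (cedges ch) ⟨
  degree u (edges (node j ch)) ∎
  where
  open ℕ.≤-Reasoning
  u = a ↑ˡ csize ch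

child-degree : ∀ {j} (ch : Children (3 + j)) u → degree u (cedges ch) ≤ degree u (edges (node j ch))
child-degree {j} ch u = ℕ.≤-trans (ℕ.m≤n+m _ (degree u (mapPair (_↑ˡ csize ch) (cycleEdges (2 + j)))))
  (ℕ.≤-reflexive (sym (degree-++ u (mapPair (_↑ˡ csize ch) (cycleEdges (2 + j))) (cedges ch))))

-- The cycle already takes two edges at `b`; a link to a child would be a third.
degree≤2⇒freeRoot : ∀ {k} (c : CycTree k) b → degree (rootV c b) (edges c) ≤ 2 → FreeRoot c b
degree≤2⇒freeRoot (node j none) b _ = tt
degree≤2⇒freeRoot (node j ch@(one a b′ c)) b ≤2 refl =
  ℕ.<⇒≱ (ℕ.≤-trans (s≤s (s≤s (ℕ.≤-trans (s≤s z≤n) (degree-here (inj₁ refl))))) (root-degree ch b)) ≤2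
degree≤2⇒freeRoot (node j ch@(two a b₁ c₁ a′ b₂ c₂)) b ≤2 =
  (λ { refl → ℕ.<⇒≱ (ℕ.≤-trans (s≤s (s≤s (ℕ.≤-trans (s≤s z≤n) (degree-here (inj₁ refl))))) (root-degree ch b)) ≤2 }) ,
  (λ { refl → ℕ.<⇒≱ (ℕ.≤-trans (s≤s (s≤s (ℕ.≤-trans (ℕ.≤-trans (s≤s z≤n) (degree-here (inj₁ refl))) degree-there)))
                      (root-degree ch b)) ≤2 })

-- Degrees inside a subtree are at most those in the whole. At the child's attachment vertex the
-- link uses one of three edges, leaving two within the child. If both links started at `a`, its
-- degree would be at least four.
degree≤3⇒distinctPorts : ∀ {k} (c : CycTree k) → (∀ v → degree v (edges c) ≤ 3) → DistinctPorts c
degree≤3⇒distinctPorts (node j none) _ = tt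
degree≤3⇒distinctPorts (node j ch@(one a b c)) ≤3 =
  degree≤3⇒distinctPorts c (λ v → ℕ.≤-trans (sub v) (ℕ.≤-trans degree-there (whole (3 + j ↑ʳ v)))) ,
  degree≤2⇒freeRoot c b (ℕ.≤-pred (ℕ.≤-trans (s≤s (sub (rootV c b)))
    (ℕ.≤-trans (degree-here (inj₂ refl)) (whole (3 + j ↑ʳ rootV c b)))))
  where
  whole : ∀ u → degree u (cedges ch) ≤ 3
  whole u = ℕ.≤-trans (child-degree ch u) (≤3 u)
  sub : ∀ v → degree v (edges c) ≤ degree (3 + j ↑ʳ v) (mapPair (3 + j ↑ʳ_) (edges c))
  sub v = degree-map (3 + j ↑ʳ_) v (edges c)
degree≤3⇒distinctPorts (node j ch@(two a b c a′ b′ c′)) ≤3 =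
  (λ { refl → ℕ.<⇒≱ (ℕ.≤-trans (s≤s (s≤s (ℕ.≤-trans (s≤s (ℕ.≤-trans (s≤s z≤n) (degree-here (inj₁ refl))))
                                                      (degree-here (inj₁ refl)))))
                      (root-degree ch a)) (≤3 (a ↑ˡ csize ch)) }) ,
  (degree≤3⇒distinctPorts c (λ v → ℕ.≤-trans (subˡ v)
     (ℕ.≤-trans degree-there (ℕ.≤-trans degree-there (whole (inˡ v))))) ,
   degree≤2⇒freeRoot c b (ℕ.≤-pred (ℕ.≤-trans (s≤s (ℕ.≤-trans (subˡ (rootV c b)) degree-there))
     (ℕ.≤-trans (degree-here (inj₂ refl)) (whole (inˡ (rootV c b))))))) ,
  (degree≤3⇒distinctPorts c′ (λ v → ℕ.≤-trans (subʳ v)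
     (ℕ.≤-trans degree-there (ℕ.≤-trans degree-there (whole (inʳ v))))) ,
   degree≤2⇒freeRoot c′ b′ (ℕ.≤-pred (ℕ.≤-trans (s≤s (subʳ (rootV c′ b′)))
     (ℕ.≤-trans (degree-here (inj₂ refl)) (ℕ.≤-trans degree-there (whole (inʳ (rootV c′ b′))))))))
  where
  whole : ∀ u → degree u (cedges ch) ≤ 3
  whole u = ℕ.≤-trans (child-degree ch u) (≤3 u)
  inˡ : Fin (size c) → Fin (3 + j + csize ch)
  inˡ v = 3 + j ↑ʳ (v ↑ˡ size c′)
  inʳ : Fin (size c′) → Fin (3 + j + csize ch)
  inʳ v = 3 + j ↑ʳ (size c ↑ʳ v)
  subˡ : ∀ v → degree v (edges c) ≤ degree (inˡ v) (mapPair inˡ (edges c) ++ mapPair inʳ (edges c′))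
  subˡ v = ℕ.≤-trans (degree-map inˡ v (edges c)) (degree-++ˡ (mapPair inˡ (edges c)))
  subʳ : ∀ v → degree v (edges c′) ≤ degree (inʳ v) (mapPair inˡ (edges c) ++ mapPair inʳ (edges c′))
  subʳ v = ℕ.≤-trans (degree-map inʳ v (edges c′)) (degree-++ʳ (mapPair inˡ (edges c)))

-- From a layout to an embedding on the point set.

injective⇒surjective : ∀ {n} {f : Fin n → Fin n} → Injective _≡_ _≡_ f → ∀ c → Σ[ i ∈ Fin n ] f i ≡ c
injective⇒surjective {suc n} {f} inj c with Fin.any? (λ i → f i ≟ᶠ c)
... | yes hit = hit
-- An injection missing `c` would, with `c` punched out, embed `Fin (suc n)` into `Fin n`.
... | no miss = contradiction
  (Fin.injective⇒≤ {f = λ i → punchOut (c≢f i)} (λ {i} {i′} eq → inj (Fin.punchOut-injective (c≢f i) (c≢f i′) eq)))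
  (ℕ.<-irrefl refl)
  where
  c≢f : ∀ i → c ≢ f i
  c≢f i eq = miss (i , sym eq)

Loopless : ∀ {n} → List (Fin n × Fin n) → Set
Loopless = All (λ e → proj₁ e ≢ proj₂ e)

loopless-map : ∀ {m n} {f : Fin m → Fin n} → Injective _≡_ _≡_ f → ∀ {es} → Loopless es → Loopless (mapPair f es)
loopless-map inj = All.map⁺ ∘ All.map (_∘ inj)

↑ˡ≢↑ʳ : ∀ {m n} (i : Fin m) (i′ : Fin n) → i ↑ˡ n ≢ m ↑ʳ i′
↑ˡ≢↑ʳ {m} {n} i i′ eq
  with () ← trans (sym (Fin.splitAt-↑ˡ m i n)) (trans (cong (splitAt m) eq) (Fin.splitAt-↑ʳ m n i′))

edges-loopless : ∀ {k} (c : CycTree k) → Loopless (edges c)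
edges-loopless (node j ch) =
  All.++⁺ (loopless-map (Fin.↑ˡ-injective _ _ _) cycle-loopless) (children-loopless ch)
  where
  cycle-loopless : Loopless (cycleEdges (2 + j))
  cycle-loopless = subst Loopless (sym (cycleEdges-tabulate (2 + j))) (All.tabulate⁺ prv≢id)

  children-loopless : (ch : Children (3 + j)) → Loopless (cedges ch)
  children-loopless none        = []
  children-loopless (one a b c) = ↑ˡ≢↑ʳ a _ ∷ loopless-map (Fin.↑ʳ-injective _ _ _) (edges-loopless c)
  children-loopless (two a b c a′ b′ c′) = ↑ˡ≢↑ʳ a _ ∷ ↑ˡ≢↑ʳ a′ _ ∷ All.++⁺
    (loopless-map (λ eq → Fin.↑ˡ-injective _ _ _ (Fin.↑ʳ-injective _ _ _ eq)) (edges-loopless c))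
    (loopless-map (λ eq → Fin.↑ʳ-injective (size c) _ _ (Fin.↑ʳ-injective (3 + j) _ _ eq)) (edges-loopless c′))

module _ {n : ℕ} (S : Fin n → Point) (grid : GridPointSet n S) where

  private
    column : ∀ {z} → + 1 ≤ℤ z → z ≤ℤ + n → Σ[ c ∈ Fin n ] z ≡ + suc (toℕ c)
    -- Coordinates start at 1, columns at 0.
    column {+ suc z} _ (+≤+ z<n)      = fromℕ< z<n , cong (+_ ∘ suc) (sym (Fin.toℕ-fromℕ< z<n))
    column {+ zero} (+≤+ ()) _

    rank : Fin n → Fin n
    rank i = proj₁ (column (proj₁ (proj₁ (proj₁ grid i))) (proj₂ (proj₁ (proj₁ grid i))))

    px-rank : ∀ i → px (S i) ≡ + suc (toℕ (rank i))
    px-rank i = proj₂ (column (proj₁ (proj₁ (proj₁ grid i))) (proj₂ (proj₁ (proj₁ grid i))))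

    rank-injective : Injective _≡_ _≡_ rank
    rank-injective {i} {i′} eq with i ≟ᶠ i′
    ... | yes i≡i′ = i≡i′
    ... | no  i≢i′ = contradiction
      (trans (px-rank i) (trans (cong (+_ ∘ suc ∘ toℕ) eq) (sym (px-rank i′)))) (proj₁ (proj₂ grid i i′ i≢i′))

  -- The `n` points occupy distinct columns among `n`, hence every column exactly once, and `rank`
  -- can be inverted.
  pointAt : Fin n → Fin n
  pointAt c = proj₁ (injective⇒surjective rank-injective c)

  px-pointAt : ∀ c → px (S (pointAt c)) ≡ + suc (toℕ c)
  px-pointAt c = trans (px-rank _) (cong (+_ ∘ suc ∘ toℕ) (proj₂ (injective⇒surjective rank-injective c)))

  pointAt-injective : Injective _≡_ _≡_ pointAt
  pointAt-injective {c} {c′} eq = Fin.toℕ-injective (ℕ.suc-injective (ℤ.+-injective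
    (trans (sym (px-pointAt c)) (trans (cong (px ∘ S) eq) (px-pointAt c′)))))

  -- Columns c ≥ n carry no point; the values there only make height injective.
  height : ℕ → ℤ
  height c with c <? n
  ... | yes c<n = py (S (pointAt (fromℕ< c<n)))
  ... | no  _   = + suc c

  height-pointAt : ∀ {c} (c<n : c < n) → height c ≡ py (S (pointAt (fromℕ< c<n)))
  height-pointAt {c} c<n with c <? n
  ... | yes _   = refl
  ... | no  c≮n = contradiction c<n c≮n

  -- Actual points have height at most `n`, while a column `c` without a point has height `suc c`,
  -- which exceeds `n`, so the two kinds never collide.
  height-injective : Injective _≡_ _≡_ height
  height-injective {c} {c′} eq with c <? n | c′ <? n
  ... | no  _   | no  _    = ℕ.suc-injective (ℤ.+-injective eq)
  ... | yes c<n | no  c′≮n = contradiction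
    (ℤ.drop‿+≤+ (subst (_≤ℤ + n) eq (proj₂ (proj₂ (proj₁ grid _))))) c′≮n
  ... | no  c≮n | yes c′<n = contradiction
    (ℤ.drop‿+≤+ (subst (_≤ℤ + n) (sym eq) (proj₂ (proj₂ (proj₁ grid _))))) c≮n
  ... | yes c<n | yes c′<n with pointAt (fromℕ< c<n) ≟ᶠ pointAt (fromℕ< c′<n)
  ...   | yes same = Fin.fromℕ<-injective c c′ c<n c′<n (pointAt-injective same)
  ...   | no  diff = contradiction eq (proj₂ (proj₂ grid _ _ diff))

  open Columns height height-injective

  module Realize (es : List (Fin n × Fin n)) (loopless : Loopless es) (L : Layout es (Window 0 (n + 0))) where

    private
      κ : Fin n → ℕ
      κ = col (placement L)

      κ<n : ∀ v → κ v < n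
      κ<n v = subst (κ v <_) (ℕ.+-identityʳ n) (proj₂ (window (placement L) v))

      μ : Fin n → Fin n
      μ v = pointAt (fromℕ< (κ<n v))

      μ-injective : Injective _≡_ _≡_ μ
      μ-injective eq = injective (placement L) (Fin.fromℕ<-injective _ _ (κ<n _) (κ<n _) (pointAt-injective eq))

      μ-bijective : Bijective _≡_ _≡_ μ
      μ-bijective = μ-injective , λ c → let (v , eq) = injective⇒surjective μ-injective c in v , λ { refl → eq }

      px-μ : ∀ v → px (S (μ v)) ≡ + suc (κ v)
      px-μ v = trans (px-pointAt _) (cong (+_ ∘ suc) (Fin.toℕ-fromℕ< (κ<n v)))

      py-μ : ∀ v → py (S (μ v)) ≡ height (κ v)
      py-μ v = sym (height-pointAt (κ<n v))

      -- The layout stores columns only; the alternative of `Drawn` that holds tells which end of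
      -- the edge is left horizontally.
      orient : ∀ {es ds} → Pointwise (Drawn κ) es ds → Fin (length es) → Fin n × Fin n
      orient               (_ ∷ drs)    (suc e) = orient drs e
      orient {(u , v) ∷ _} (inj₁ _ ∷ _) zero    = u , v
      orient {(u , v) ∷ _} (inj₂ _ ∷ _) zero    = v , u

      columns : Fin n × Fin n → ℕ × ℕ
      columns (h , v) = κ h , κ v

      orient-ends : ∀ {es ds} (drs : Pointwise (Drawn κ) es ds) e →
                    lookup es e ≡ orient drs e ⊎ lookup es e ≡ (proj₂ (orient drs e) , proj₁ (orient drs e))
      orient-ends (inj₁ _ ∷ _) zero    = inj₁ refl
      orient-ends (inj₂ _ ∷ _) zero    = inj₂ refl
      orient-ends (_ ∷ drs)    (suc e) = orient-ends drs e

      orient-loopless : ∀ {es ds} (drs : Pointwise (Drawn κ) es ds) → Loopless es → ∀ e →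
                        proj₁ (orient drs e) ≢ proj₂ (orient drs e)
      orient-loopless (inj₁ _ ∷ _) (u≢v ∷ _) zero    = u≢v
      orient-loopless (inj₂ _ ∷ _) (u≢v ∷ _) zero    = ≢-sym u≢v
      orient-loopless (_ ∷ drs)    (_ ∷ ne)  (suc e) = orient-loopless drs ne e

      orient-all : ∀ {P : ℕ × ℕ → Set} {es ds} (drs : Pointwise (Drawn κ) es ds) → All P ds → ∀ e →
                   P (columns (orient drs e))
      orient-all (inj₁ refl ∷ _) (p ∷ _)  zero    = p
      orient-all (inj₂ refl ∷ _) (p ∷ _)  zero    = p
      orient-all (_ ∷ drs)       (_ ∷ ps) (suc e) = orient-all drs ps e

      orient-compat : ∀ {es ds} (drs : Pointwise (Drawn κ) es ds) → AllPairs Compat ds → ∀ {e f} → e ≢ f →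
                      Compat (columns (orient drs e)) (columns (orient drs f))
      orient-compat (_ ∷ _)           _        {zero}  {zero}  e≢f = contradiction refl e≢f
      orient-compat (inj₁ refl ∷ drs) (c ∷ _)  {zero}  {suc f} _   = orient-all drs c f
      orient-compat (inj₂ refl ∷ drs) (c ∷ _)  {zero}  {suc f} _   = orient-all drs c f
      orient-compat (inj₁ refl ∷ drs) (c ∷ _)  {suc e} {zero}  _   = compat-sym (orient-all drs c e)
      orient-compat (inj₂ refl ∷ drs) (c ∷ _)  {suc e} {zero}  _   = compat-sym (orient-all drs c e)
      orient-compat (_ ∷ drs)         (_ ∷ cs) {suc e} {suc f} e≢f = orient-compat drs cs (e≢f ∘ cong suc)

      x-mid : ∀ {u v w} → Mid _<_ (κ u) (κ v) (κ w) → Mid _<ℤ_ (px (S (μ u))) (px (S (μ v))) (px (S (μ w)))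
      x-mid {u} {v} {w} mid rewrite px-μ u | px-μ v | px-μ w =
        [ (λ (p , q) → inj₁ (+<+ (s≤s p) , +<+ (s≤s q))) , (λ (p , q) → inj₂ (+<+ (s≤s p) , +<+ (s≤s q))) ] mid

      y-mid : ∀ {u v w} → Mid _≺_ (κ u) (κ v) (κ w) → Mid _<ℤ_ (py (S (μ u))) (py (S (μ v))) (py (S (μ w)))
      y-mid {u} {v} {w} mid rewrite py-μ u | py-μ v | py-μ w = mid

    realize : RestrictedRAC₁ (record { V = n ; m = length es ; E = lookup es }) S
    realize = lShaped⇒RAC₁ _ S grid μ μ-bijective record
      { hor       = proj₁ ∘ orient (drawn L)
      ; ver       = proj₂ ∘ orient (drawn L)
      ; ends      = orient-ends (drawn L)
      ; loopless  = orient-loopless (drawn L) loopless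
      ; hor-split = λ e≢f eq → x-mid (proj₁ (orient-compat (drawn L) (compat L) e≢f) (cong κ eq))
      ; ver-split = λ e≢f eq → y-mid (proj₂ (orient-compat (drawn L) (compat L) e≢f) (cong κ eq))
      }

someFreeRoot : ∀ {k} (c : CycTree k) → Σ[ b ∈ Fin k ] FreeRoot c b
someFreeRoot (node j none)               = zero , tt
someFreeRoot (node j (one a _ _))        = let (b , b≢a , _) = fresh a a in b , b≢a
someFreeRoot (node j (two a _ _ a′ _ _)) = fresh a a′

theorem2 : ∀ {k} (T : CycTree k) →
    MaxDegAtMost 3 (toGraph T) →
    (S : Fin (V (toGraph T)) → Point) → GridPointSet (V (toGraph T)) S →
    RestrictedRAC₁ (toGraph T) S
theorem2 T deg≤3 S grid = Realize.realize S grid (edges T) (edges-loopless T)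
    -- The root has no parent, so any free vertex serves as `b`, and `size T`, the first column
    -- beyond the window, serves as `q`.
    (proj₁ (treeLayout T ports b free 0 (size T) (λ (_ , n<n) → ℕ.<-irrefl (sym (ℕ.+-identityʳ (size T))) n<n)))
  where
  open Columns (height S grid) (height-injective S grid)
  ports : DistinctPorts T
  ports = degree≤3⇒distinctPorts T (λ v → subst (_≤ 3) (deg-toGraph T v) (deg≤3 v))
  b    = proj₁ (someFreeRoot T)
  free = proj₂ (someFreeRoot T)
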